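{- Let $d$ be a positive integer. (1) If $D=T^{2d}+T^{e}$ with $0\le e<d$, then the partial quotients $a_h$ ($h\ge0$) of the continued fraction expansion of $\sqrt D$ satisfy $\deg a_h=d$ for $h$ even and $\deg a_h=d-e$ for $h$ odd. (2) If $D=T^{2d}+T^{d}$, then all partial quotients $a_h$ ($h\ge0$) of the continued fraction expansion of $\sqrt D$ have degree $d$. Moreover, in both cases $l(\sqrt D)=d$.
   Context: $\mathbb{Q}((1/T))$ is the field of formal Laurent series $\sum_{i=-\infty}^m c_iT^i$, $c_i\in\mathbb{Q}$; $\deg$ of a nonzero series is the exponent of its leading term, $\deg 0=-\infty$. $\sqrt D\in\mathbb{Q}((1/T))$ denotes the square root $T^d(1+\dots)$ of $D$. The continued fraction expansion $[a_0,a_1,\dots]$ of $\alpha$ is given by $\alpha_0=\alpha$, $a_i=\lfloor\alpha_i\rfloor$ (the sum of the terms of nonnegative degree), $\alpha_{i+1}=(\alpha_i-a_i)^{ -1}$. For $\alpha\notin\mathbb{Q}(T)$, the Lagrange constant $l(\alpha)\in\mathbb{Z}\cup\{\infty\}$ is the supremum of integers $k$ such that $\deg(\alpha-p/q)\le-2\deg q-k$ for infinitely many $p,q\in\mathbb{Q}[T]$, $q\ne0$. -}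

module Defs where

open import Data.Bool.Base using (if_then_else_)
open import Data.Fin.Base using (Fin; toℕ)
open import Data.Integer.Base as ℤ using (ℤ; +_; -[1+_])
import Data.Integer.Properties as ℤ
open import Data.List.Base using (List)
open import Data.List.Relation.Unary.All using (All)
open import Data.Nat.Base as ℕ using (ℕ; suc)
open import Data.Product.Base using (∃-syntax; _×_)
open import Data.Rational.Base as ℚ using (ℚ; 0ℚ; 1ℚ)
import Data.Rational.Properties as ℚ
open import Relation.Binary.Core using (Rel)
open import Relation.Binary.PropositionalEquality
open import Relation.Nullary.Construct.Add.Supremum public using (_⁺; ⊤⁺; [_])
open import Relation.Nullary.Decidable.Core using (does; yes; no)
open import Relation.Nullary.Negation.Core using (¬_; contradiction)

open import Algebra.Properties.CommutativeMonoid.Sum ℚ.+-0-commutativeMonoid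
  using (sum; sum-cong-≗; sum-replicate-zero)
open import Relation.Binary.Construct.Add.Supremum.NonStrict ℤ._≤_
  using (_≤⁺_)

-- The x such that P x satisfies Q.  A definite description is used where the
-- object described cannot be computed constructively from the data (inverting
-- a series requires locating its leading term).
The : ∀ {a p q} {A : Set a} → (A → Set p) → (A → Set q) → Set _
The {A = A} P Q = (∃[ x ] P x) × (∀ (x : A) → P x → Q x)

infix 4 _≈_ deg_≤_ deg_≡_
infixl 6 _+_ _-_
infixl 7 _*_
infix 8 T^_

-- ℚ((1/T)): the series Σ cᵢ Tⁱ over i ≤ bound.  The bound is merely some upper
-- bound of the support, so equality (_≈_) is equality of coefficients.
record Laurent : Set where
  field
    coeff    : ℤ → ℚ
    bound    : ℤ
    vanishes : ∀ i → bound ℤ.< i → coeff i ≡ 0ℚ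

open Laurent public

_≈_ : Rel Laurent _
f ≈ g = ∀ i → coeff f i ≡ coeff g i

T^_ : ℤ → Laurent
T^ n = record
  { coeff    = λ i → if does (i ℤ.≟ n) then 1ℚ else 0ℚ
  ; bound    = n
  ; vanishes = vanish
  }
  where
  vanish : ∀ i → n ℤ.< i → (if does (i ℤ.≟ n) then 1ℚ else 0ℚ) ≡ 0ℚ
  vanish i n<i with i ℤ.≟ n
  ... | yes i≡n = contradiction (sym i≡n) (ℤ.<⇒≢ n<i)
  ... | no  _   = refl

1# : Laurent
1# = T^ (+ 0)

_+_ : Laurent → Laurent → Laurent
f + g = record
  { coeff    = λ i → coeff f i ℚ.+ coeff g i
  ; bound    = bound f ℤ.⊔ bound g
  ; vanishes = λ i b<i → cong₂ ℚ._+_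
      (vanishes f i (ℤ.≤-<-trans (ℤ.i≤i⊔j (bound f) (bound g)) b<i))
      (vanishes g i (ℤ.≤-<-trans (ℤ.i≤j⊔i (bound f) (bound g)) b<i))
  }

-_ : Laurent → Laurent
- f = record
  { coeff    = λ i → ℚ.- coeff f i
  ; bound    = bound f
  ; vanishes = λ i b<i → cong ℚ.-_ (vanishes f i b<i)
  }

_-_ : Laurent → Laurent → Laurent
f - g = f + (- g)

-- Cauchy product: the coefficient of Tⁱ is the sum of fⱼ gᵢ₋ⱼ over j ≤ bound f
-- with i - j ≤ bound g.  Here j = bound f - n, so that n ranges from 0 to
-- bound f + bound g - i when i ≤ bound f + bound g.  For larger i the range is
-- not empty, but all its terms vanish.
_*_ : Laurent → Laurent → Laurent
f * g = record
  { coeff    = λ i → sum (term i)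
  ; bound    = bound f ℤ.+ bound g
  ; vanishes = λ i b<i → trans
      (sum-cong-≗ (λ n → term-vanishes i b<i n))
      (sum-replicate-zero (length i))
  }
  where
  length : ℤ → ℕ
  length i = suc ℤ.∣ i ℤ.- (bound f ℤ.+ bound g) ∣

  term : ∀ i → Fin (length i) → ℚ
  term i n = coeff f (bound f ℤ.- + toℕ n)
       ℚ.* coeff g (i ℤ.- (bound f ℤ.- + toℕ n))

  bound-lt : ∀ i (n : ℕ) → bound f ℤ.+ bound g ℤ.< i →
             bound g ℤ.< i ℤ.- (bound f ℤ.- + n)
  bound-lt i n b<i = ℤ.<-≤-trans
    (subst (ℤ._< i ℤ.- bound f) lhs (ℤ.+-monoˡ-< (ℤ.- bound f) b<i))
    (ℤ.+-monoʳ-≤ i (ℤ.neg-mono-≤ (ℤ.i-j≤i (bound f) (+ n))))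
    where
    lhs : bound f ℤ.+ bound g ℤ.- bound f ≡ bound g
    lhs = begin
      bound f ℤ.+ bound g ℤ.- bound f   ≡⟨ cong (ℤ._- bound f) (ℤ.+-comm (bound f) (bound g)) ⟩
      bound g ℤ.+ bound f ℤ.- bound f   ≡⟨ ℤ.+-assoc (bound g) (bound f) _ ⟩
      bound g ℤ.+ (bound f ℤ.- bound f) ≡⟨ cong (λ k → bound g ℤ.+ k) (ℤ.+-inverseʳ (bound f)) ⟩
      bound g ℤ.+ + 0                   ≡⟨ ℤ.+-identityʳ (bound g) ⟩
      bound g                           ∎
      where open ≡-Reasoning

  term-vanishes : ∀ i → bound f ℤ.+ bound g ℤ.< i → ∀ n → term i n ≡ 0ℚ
  term-vanishes i b<i n =
    trans (cong (c ℚ.*_) (vanishes g _ (bound-lt i (toℕ n) b<i))) (ℚ.*-zeroʳ c)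
    where c = coeff f (bound f ℤ.- + toℕ n)

⌊_⌋ : Laurent → Laurent
⌊ f ⌋ = record
  { coeff    = c
  ; bound    = bound f
  ; vanishes = λ { (+ n) → vanishes f (+ n) ; -[1+ n ] _ → refl }
  }
  where
  c : ℤ → ℚ
  c (+ n)      = coeff f (+ n)
  c (-[1+ _ ]) = 0ℚ

-- As deg 0 = -∞, this includes f = 0.
deg_≤_ : Laurent → ℤ → Set
deg f ≤ n = ∀ i → n ℤ.< i → coeff f i ≡ 0ℚ

-- An integer degree; in particular f is nonzero.
deg_≡_ : Laurent → ℤ → Set
deg f ≡ n = deg f ≤ n × coeff f n ≢ 0ℚ

-- ℚ[T] as a subring of ℚ((1/T)); the bound makes such a series finite.
IsPolynomial : Laurent → Set
IsPolynomial f = ∀ n → coeff f -[1+ n ] ≡ 0ℚ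

-- s is the square root Tᵈ(1 + …) of D.
IsSquareRoot : ℕ → Laurent → Laurent → Set
IsSquareRoot d D s = s * s ≈ D × deg s ≤ + d × coeff s (+ d) ≡ 1ℚ

record IsContinuedFraction (α : Laurent) (a : ℕ → Laurent) : Set where
  field
    complete      : ℕ → Laurent
    complete-zero : complete 0 ≈ α
    partial       : ∀ h → a h ≈ ⌊ complete h ⌋
    complete-suc  : ∀ h → complete (suc h) * (complete h - a h) ≈ 1#

-- A representation p/q of an element of ℚ(T), with q ≠ 0.
record Fraction : Set where
  field
    p q          : Laurent
    p-polynomial : IsPolynomial p
    q-polynomial : IsPolynomial q
    deg-q        : ℤ
    q-degree     : deg q ≡ deg-q
    p/q          : Laurent
    p/q-quotient : p/q * q ≈ p

-- P holds for infinitely many elements of A, counted up to the relation _∼_.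
Infinitely : ∀ {a ℓ p} {A : Set a} → Rel A ℓ → (A → Set p) → Set _
Infinitely {A = A} _∼_ P =
  ∀ (xs : List A) → ∃[ x ] P x × All (λ y → ¬ (x ∼ y)) xs

-- Fractions with the same value p/q are identified: otherwise the multiples
-- (cp, cq) of a single pair, c ∈ ℚ*, would already be infinitely many.
ApproximableTo : Laurent → ℤ → Set
ApproximableTo α k = Infinitely (λ x y → p/q x ≈ p/q y)
  λ x → deg (α - p/q x) ≤ (ℤ.- (+ 2 ℤ.* deg-q x) ℤ.- k)
  where open Fraction

IsUpperBound : (ℤ → Set) → ℤ ⁺ → Set
IsUpperBound S u = ∀ k → S k → [ k ] ≤⁺ u

IsSupremum : (ℤ → Set) → ℤ ⁺ → Set
IsSupremum S l = IsUpperBound S l × (∀ u → IsUpperBound S u → l ≤⁺ u)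

-- l(α) = l, where l(α) is defined only for α ∉ ℚ(T).
record IsLagrangeConstant (α : Laurent) (l : ℤ ⁺) : Set where
  field
    irrational : ∀ (x : Fraction) → ¬ (Fraction.p/q x ≈ α)
    supremum   : IsSupremum (ApproximableTo α) l

{-# OPTIONS --safe #-}
module Submission where

-- Write D = A² + ε, where A is the polynomial part of s = √D and ε is a unit:
-- A = Tᵈ, ε = Tᵉ in case (1), and A = Tᵈ + 1/2, ε = -1/4 in case (2).  Since
-- (s - A)(s + A) = ε, the complete quotients are s, (s + A)/ε, s + A, (s + A)/ε, …
-- and the partial quotients are A, 2A/ε, 2A, 2A/ε, …
--
-- The Lagrange constant is read off the Pell equation p² - Dq² = 1.  It has the
-- solution p = 1 + 2A²/ε, q = 2A/ε, and squaring p - qs yields solutions of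
-- arbitrarily large degree, whose quotients satisfy deg (s - p/q) = -2 deg q - d.
-- Comparing with such a solution shows that s is irrational.  For the upper bound,
-- the polynomial q²D - p² = q²(s - p/q)(s + p/q) is nonzero, hence of degree ≥ 0.

open import Defs
open import Algebra.Bundles using (CommutativeRing)
import Algebra.Properties.Group as GroupProperties
import Algebra.Solver.Ring
open import Algebra.Solver.Ring.AlmostCommutativeRing
  using (fromCommutativeRing; _-Raw-AlmostCommutative⟶_)
open import Algebra.Structures using (IsCommutativeRing)
open import Data.Bool.Base using (if_then_else_)
open import Data.Fin.Base using (toℕ)
import Data.Fin.Properties as Fin
open import Data.Integer.Base as ℤ using (ℤ; +_; -[1+_])
import Data.Integer.Properties as ℤ
open import Data.Integer.Tactic.RingSolver using (solve-∀)
open import Data.List.Base using ([]; _∷_)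
open import Data.List.Relation.Unary.All as All using (All; []; _∷_)
open import Data.Maybe.Base using (Maybe; just; nothing)
open import Data.Nat.Base as ℕ using (ℕ; zero; suc)
open import Data.Nat.Divisibility
  using (_∣_; _∤_; _∣?_; _∣0; ∣-refl; ∣⇒≤; ∣m+n∣m⇒∣n; ∣m∣n⇒∣m+n)
import Data.Nat.Properties as ℕ
import Data.Nat.Tactic.RingSolver as ℕSolver
open import Data.Product.Base using (∃-syntax; _×_; _,_; proj₁; proj₂)
open import Data.Rational.Base as ℚ using (ℚ; 0ℚ; 1ℚ; ½)
import Data.Rational.Properties as ℚ
open import Data.Sum.Base using (inj₁; inj₂)
open import Function.Base using (_∘_)
open import Level using (0ℓ)
open import Relation.Binary.Construct.Add.Supremum.NonStrict ℤ._≤_ using ([_])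
open import Relation.Binary.PropositionalEquality hiding (setoid)
import Relation.Binary.Reasoning.Setoid as SetoidReasoning
open import Relation.Nullary.Decidable.Core using (does; yes; no)
open import Relation.Nullary.Negation.Core using (¬_; contradiction)

open import Algebra.Properties.CommutativeMonoid.Sum ℚ.+-0-commutativeMonoid
  using (sum; sum-cong-≗; sum-replicate-zero)
open import Algebra.Properties.CommutativeSemigroup
  (CommutativeRing.+-commutativeSemigroup ℚ.+-*-commutativeRing) using (interchange)

-- The ring of Laurent series

-- The product of series is computed from the stored bounds, which `_≈_` ignores, so even its
-- congruence has to be proved; series are therefore treated as power series in 1/T based at an
-- arbitrary bound of the support. Whether a series is zero cannot be decided, so degrees occur as
-- upper bounds, and exact degrees only through a leading coefficient shown to be nonzero. Inverses
-- and square roots come from a fixed point theorem. In case (2) the polynomial part is not Tᵈ: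
-- completing the square moves the term Tᵈ into A. What is left of D has degree 0, so this is the
-- general situation with e = 0, and the two alternating degrees d and d - e coincide.
-- Approximations are counted by the value p/q, so infinitely many Pell solutions need not be
-- infinitely many approximations. The norm equation makes p and q coprime, hence a q of large
-- degree cannot belong to a value that also has a small denominator.

Coefficients : Set
Coefficients = ℕ → ℚ

tail : Coefficients → Coefficients
tail F = F ∘ suc

-- Peeling off the first coefficient of the left factor lets bilinearity and associativity go by
-- induction, without reindexing double sums.
convolve : Coefficients → Coefficients → Coefficients
convolve F G zero    = F 0 ℚ.* G 0
convolve F G (suc n) = F 0 ℚ.* G (suc n) ℚ.+ convolve (tail F) G n

convolve-cong : ∀ {F F′ G G′} → F ≗ F′ → G ≗ G′ → convolve F G ≗ convolve F′ G′
convolve-cong F≗ G≗ zero    = cong₂ ℚ._*_ (F≗ 0) (G≗ 0)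
convolve-cong F≗ G≗ (suc n) = cong₂ ℚ._+_
  (cong₂ ℚ._*_ (F≗ 0) (G≗ (suc n))) (convolve-cong (F≗ ∘ suc) G≗ n)

convolve-distribʳ : ∀ F F′ G n →
  convolve (λ k → F k ℚ.+ F′ k) G n ≡ convolve F G n ℚ.+ convolve F′ G n
convolve-distribʳ F F′ G zero    = ℚ.*-distribʳ-+ (G 0) (F 0) (F′ 0)
convolve-distribʳ F F′ G (suc n) = trans
  (cong₂ ℚ._+_ (ℚ.*-distribʳ-+ (G (suc n)) (F 0) (F′ 0))
               (convolve-distribʳ (tail F) (tail F′) G n))
  (interchange (F 0 ℚ.* G (suc n)) (F′ 0 ℚ.* G (suc n)) _ _)

convolve-*ˡ : ∀ c F G n → convolve (λ k → c ℚ.* F k) G n ≡ c ℚ.* convolve F G n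
convolve-*ˡ c F G zero    = ℚ.*-assoc c (F 0) (G 0)
convolve-*ˡ c F G (suc n) = trans
  (cong₂ ℚ._+_ (ℚ.*-assoc c (F 0) (G (suc n))) (convolve-*ˡ c (tail F) G n))
  (sym (ℚ.*-distribˡ-+ c _ _))

convolve-zeroˡ : ∀ G n → convolve (λ _ → 0ℚ) G n ≡ 0ℚ
convolve-zeroˡ G zero    = ℚ.*-zeroˡ (G 0)
convolve-zeroˡ G (suc n) = cong₂ ℚ._+_ (ℚ.*-zeroˡ (G (suc n))) (convolve-zeroˡ G n)

-- The mirror image of the defining recursion, peeling the right factor; the induction for
-- commutativity rests on it.
convolve-suc : ∀ F G n →
  convolve F G (suc n) ≡ convolve F (tail G) n ℚ.+ F (suc n) ℚ.* G 0
convolve-suc F G zero    = refl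
convolve-suc F G (suc n) = trans
  (cong (F 0 ℚ.* G (suc (suc n)) ℚ.+_) (convolve-suc (tail F) G n))
  (sym (ℚ.+-assoc (F 0 ℚ.* G (suc (suc n))) _ _))

convolve-comm : ∀ F G n → convolve F G n ≡ convolve G F n
convolve-comm F G zero    = ℚ.*-comm (F 0) (G 0)
convolve-comm F G (suc n) = begin
  convolve F G (suc n)                            ≡⟨ convolve-suc F G n ⟩
  convolve F (tail G) n ℚ.+ F (suc n) ℚ.* G 0     ≡⟨ ℚ.+-comm _ (F (suc n) ℚ.* G 0) ⟩
  F (suc n) ℚ.* G 0 ℚ.+ convolve F (tail G) n     ≡⟨ cong₂ ℚ._+_ (ℚ.*-comm (F (suc n)) (G 0))
                                                                  (convolve-comm F (tail G) n) ⟩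
  convolve G F (suc n)                            ∎
  where open ≡-Reasoning

convolve-assoc : ∀ F G H n →
  convolve (convolve F G) H n ≡ convolve F (convolve G H) n
convolve-assoc F G H zero    = ℚ.*-assoc (F 0) (G 0) (H 0)
convolve-assoc F G H (suc n) = begin
  (F 0 ℚ.* G 0) ℚ.* H (suc n) ℚ.+
    convolve (λ k → F 0 ℚ.* G (suc k) ℚ.+ convolve (tail F) G k) H n
    ≡⟨ cong₂ ℚ._+_ (ℚ.*-assoc (F 0) (G 0) (H (suc n)))
         (convolve-distribʳ (λ k → F 0 ℚ.* G (suc k)) (convolve (tail F) G) H n) ⟩
  F 0 ℚ.* (G 0 ℚ.* H (suc n)) ℚ.+
    (convolve (λ k → F 0 ℚ.* G (suc k)) H n ℚ.+ convolve (convolve (tail F) G) H n)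
    ≡⟨ ℚ.+-assoc (F 0 ℚ.* (G 0 ℚ.* H (suc n))) _ _ ⟨
  F 0 ℚ.* (G 0 ℚ.* H (suc n)) ℚ.+
    convolve (λ k → F 0 ℚ.* G (suc k)) H n ℚ.+ convolve (convolve (tail F) G) H n
    ≡⟨ cong₂ ℚ._+_
         (trans (cong (F 0 ℚ.* (G 0 ℚ.* H (suc n)) ℚ.+_) (convolve-*ˡ (F 0) (tail G) H n))
                (sym (ℚ.*-distribˡ-+ (F 0) (G 0 ℚ.* H (suc n)) _)))
         (convolve-assoc (tail F) G H n) ⟩
  F 0 ℚ.* convolve G H (suc n) ℚ.+ convolve (tail F) (convolve G H) n ∎
  where open ≡-Reasoning

δ : ℚ → Coefficients
δ c zero    = c
δ c (suc _) = 0ℚ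

convolve-δˡ : ∀ c G n → convolve (δ c) G n ≡ c ℚ.* G n
convolve-δˡ c G zero    = refl
convolve-δˡ c G (suc n) =
  trans (cong (c ℚ.* G (suc n) ℚ.+_) (convolve-zeroˡ G n)) (ℚ.+-identityʳ _)

sum-convolve : ∀ F G n →
  sum {suc n} (λ k → F (toℕ k) ℚ.* G (n ℕ.∸ toℕ k)) ≡ convolve F G n
sum-convolve F G zero    = ℚ.+-identityʳ (F 0 ℚ.* G 0)
sum-convolve F G (suc n) = cong (F 0 ℚ.* G (suc n) ℚ.+_) (sum-convolve (tail F) G n)

-- Because of the extension by zero, the single equation in `Represents` also says that all
-- coefficients above `b` vanish.
at : Coefficients → ℤ → ℚ
at F (+ n)    = F n
at F -[1+ n ] = 0ℚ

at-cong : ∀ {F G} → F ≗ G → at F ≗ at G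
at-cong F≗G (+ n)    = F≗G n
at-cong F≗G -[1+ n ] = refl

-- f = Σ F(n) T^(b-n).
record Represents (f : Laurent) (b : ℤ) (F : Coefficients) : Set where
  constructor representation
  field coefficients : ∀ i → coeff f i ≡ at F (b ℤ.- i)

open Represents

expand : Laurent → ℤ → Coefficients
expand f b n = coeff f (b ℤ.- + n)

m-[m-n]≡n : ∀ m n → m ℤ.- (m ℤ.- n) ≡ n
m-[m-n]≡n = solve-∀

slack : ∀ {i j} n → i ℤ.+ + n ≡ j → i ℤ.≤ j
slack {i} n refl = ℤ.i≤i+j i (+ n)

slack< : ∀ {i j} n → i ℤ.+ + suc n ≡ j → i ℤ.< j
slack< {i} n refl = ℤ.suc[i]≤j⇒i<j (slack n (eq i (+ n)))
  where
  eq : ∀ i n → ℤ.1ℤ ℤ.+ i ℤ.+ n ≡ i ℤ.+ (ℤ.1ℤ ℤ.+ n)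
  eq = solve-∀

i<j⇒j-i≡+suc : ∀ {i j} → i ℤ.< j → ∃[ n ] j ℤ.- i ≡ + suc n
i<j⇒j-i≡+suc {i} {j} i<j with j ℤ.- i in eq
... | + suc n  = n , refl
... | + 0      = contradiction (sym (ℤ.i-j≡0⇒i≡j j i eq)) (ℤ.<⇒≢ i<j)
... | -[1+ n ] = contradiction (subst (+ 0 ℤ.≤_) eq (ℤ.i≤j⇒0≤j-i (ℤ.<⇒≤ i<j))) λ()

at-neg : ∀ F {i j} → i ℤ.< j → at F (i ℤ.- j) ≡ 0ℚ
at-neg F {i} {j} i<j with i<j⇒j-i≡+suc i<j
... | n , eq = cong (at F) (trans (flip-sign i j) (cong ℤ.-_ eq))
  where
  flip-sign : ∀ i j → i ℤ.- j ≡ ℤ.- (j ℤ.- i)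
  flip-sign = solve-∀

represents-coeff : ∀ {f b F} → Represents f b F → expand f b ≗ F
represents-coeff {b = b} {F} rep n = trans (coefficients rep _) (cong (at F) (m-[m-n]≡n b (+ n)))

represents-leading : ∀ {f b F} → Represents f b F → coeff f b ≡ F 0
represents-leading {f} {b} rep =
  trans (cong (coeff f) (sym (ℤ.+-identityʳ b))) (represents-coeff rep 0)

represents⇒deg : ∀ {f b F} → Represents f b F → deg f ≤ b
represents⇒deg {F = F} rep i b<i = trans (coefficients rep i) (at-neg F b<i)

expand-represents : ∀ {f b} → deg f ≤ b → Represents f b (expand f b)
expand-represents {f} {b} deg-f = representation at-expand
  where
  at-expand : ∀ i → coeff f i ≡ at (expand f b) (b ℤ.- i)
  at-expand i with b ℤ.- i in eq
  ... | + n      = cong (coeff f) (trans (sym (m-[m-n]≡n b i)) (cong (λ z → b ℤ.- z) eq))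
  ... | -[1+ n ] = deg-f i (ℤ.≰⇒> λ i≤b →
    contradiction (subst (+ 0 ℤ.≤_) eq (ℤ.i≤j⇒0≤j-i i≤b)) λ())

≗⇒represents : ∀ {f b F} → deg f ≤ b → expand f b ≗ F → Represents f b F
≗⇒represents {f} {b} deg-f eq = representation λ i →
  trans (coefficients (expand-represents {f} deg-f) i) (at-cong eq (b ℤ.- i))

represents⇒≈ : ∀ {f g b c F G} → Represents f b F → Represents g c G →
               b ≡ c → F ≗ G → f ≈ g
represents⇒≈ {b = b} rf rg refl F≗G i =
  trans (coefficients rf i) (trans (at-cong F≗G (b ℤ.- i)) (sym (coefficients rg i)))

bound-represents : ∀ f → Represents f (bound f) (expand f (bound f))
bound-represents f = expand-represents {f} (vanishes f)

*-represents-bound : ∀ f g → Represents (f * g) (bound f ℤ.+ bound g)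
  (convolve (expand f (bound f)) (expand g (bound g)))
*-represents-bound f g = ≗⇒represents {f * g} (vanishes (f * g)) λ n →
  trans (Cauchy n _ (length n)) (sum-convolve (expand f b) (expand g c) n)
  where
  b = bound f
  c = bound g

  length : ∀ n → ℤ.∣ b ℤ.+ c ℤ.- + n ℤ.- (b ℤ.+ c) ∣ ≡ n
  length n = trans (cong ℤ.∣_∣ (eq (b ℤ.+ c) (+ n))) (ℤ.∣-i∣≡∣i∣ (+ n))
    where
    eq : ∀ i n → i ℤ.- n ℤ.- i ≡ ℤ.- n
    eq = solve-∀

  -- The number of summands is an index of `sum`, so it is abstracted to `l`; matching on `l ≡ n`
  -- replaces a transport along `length`.
  Cauchy : ∀ n l → l ≡ n →
    sum {suc l} (λ k → coeff f (b ℤ.- + toℕ k)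
                   ℚ.* coeff g (b ℤ.+ c ℤ.- + n ℤ.- (b ℤ.- + toℕ k)))
    ≡ sum {suc n} (λ k → expand f b (toℕ k) ℚ.* expand g c (n ℕ.∸ toℕ k))
  Cauchy n _ refl = sum-cong-≗ {suc n} λ k →
    cong (λ i → expand f b (toℕ k) ℚ.* coeff g i)
      (trans (index b c (+ n) (+ toℕ k))
        (cong (λ i → c ℤ.- i) (trans (ℤ.m-n≡m⊖n n (toℕ k)) (ℤ.⊖-≥ (Fin.toℕ≤pred[n] k)))))
    where
    index : ∀ b c n k → b ℤ.+ c ℤ.- n ℤ.- (b ℤ.- k) ≡ c ℤ.- (n ℤ.- k)
    index = solve-∀

-- A zero in front of the left factor shifts the product by one. The borderline is the index -1: it
-- moves to 0, where the product is F′(0) G(0) = 0.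
convolve-shift : ∀ {F F′} G → F′ 0 ≡ 0ℚ → tail F′ ≗ F → ∀ i →
  at (convolve F′ G) (ℤ.suc i) ≡ at (convolve F G) i
convolve-shift {F} {F′} G F′0 F′s (+ n) = begin
  F′ 0 ℚ.* G (suc n) ℚ.+ convolve (tail F′) G n
    ≡⟨ cong₂ ℚ._+_ (cong (ℚ._* G (suc n)) F′0) (convolve-cong F′s (λ _ → refl) n) ⟩
  0ℚ ℚ.* G (suc n) ℚ.+ convolve F G n
    ≡⟨ cong (ℚ._+ convolve F G n) (ℚ.*-zeroˡ (G (suc n))) ⟩
  0ℚ ℚ.+ convolve F G n
    ≡⟨ ℚ.+-identityˡ _ ⟩
  convolve F G n ∎
  where open ≡-Reasoning
convolve-shift G F′0 F′s -[1+ zero ] = trans (cong (ℚ._* G 0) F′0) (ℚ.*-zeroˡ (G 0))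
convolve-shift G F′0 F′s -[1+ suc n ] = refl

-- Raising the bound by k prepends k zeros to the expansion, as the coefficients above `b` vanish.
convolve-expand-+ : ∀ f G {b} k i → deg f ≤ b →
  at (convolve (expand f (b ℤ.+ + k)) G) (+ k ℤ.+ i) ≡ at (convolve (expand f b) G) i
convolve-expand-+ f G {b} zero i deg-f =
  trans (cong (at (convolve (expand f (b ℤ.+ + 0)) G)) (ℤ.+-identityˡ i))
        (at-cong (convolve-cong (λ n → cong (λ j → coeff f (j ℤ.- + n)) (ℤ.+-identityʳ b))
                                λ _ → refl) i)
convolve-expand-+ f G {b} (suc k) i deg-f = begin
  at (convolve (expand f (b ℤ.+ + suc k)) G) (+ suc k ℤ.+ i)
    ≡⟨ cong (at (convolve (expand f (b ℤ.+ + suc k)) G)) (ℤ.suc-+ k i) ⟩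
  at (convolve (expand f (b ℤ.+ + suc k)) G) (ℤ.suc (+ k ℤ.+ i))
    ≡⟨ convolve-shift G
         (deg-f _ (slack< k (sym (ℤ.+-identityʳ (b ℤ.+ + suc k)))))
         (λ n → cong (coeff f) (index b (+ k) (+ n))) (+ k ℤ.+ i) ⟩
  at (convolve (expand f (b ℤ.+ + k)) G) (+ k ℤ.+ i)
    ≡⟨ convolve-expand-+ f G k i deg-f ⟩
  at (convolve (expand f b) G) i ∎
  where
  open ≡-Reasoning
  index : ∀ b k n → b ℤ.+ (ℤ.1ℤ ℤ.+ k) ℤ.- (ℤ.1ℤ ℤ.+ n) ≡ b ℤ.+ k ℤ.- n
  index = solve-∀

convolve-expand-≤ : ∀ f G {b b′} c i → deg f ≤ b → b ℤ.≤ b′ →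
  at (convolve (expand f b) G) (b ℤ.+ c ℤ.- i) ≡
  at (convolve (expand f b′) G) (b′ ℤ.+ c ℤ.- i)
convolve-expand-≤ f G {b} {b′} c i deg-f b≤b′ = begin
  at (convolve (expand f b) G) (b ℤ.+ c ℤ.- i)
    ≡⟨ convolve-expand-+ f G k (b ℤ.+ c ℤ.- i) deg-f ⟨
  at (convolve (expand f (b ℤ.+ + k)) G) (+ k ℤ.+ (b ℤ.+ c ℤ.- i))
    ≡⟨ cong₂ (λ z w → at (convolve (expand f z) G) w) b+k≡b′
         (trans (shuffle b c i (+ k)) (cong (λ z → z ℤ.+ c ℤ.- i) b+k≡b′)) ⟩
  at (convolve (expand f b′) G) (b′ ℤ.+ c ℤ.- i) ∎
  where
  open ≡-Reasoning
  k = ℤ.∣ b′ ℤ.- b ∣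
  cancel : ∀ i j → i ℤ.+ (j ℤ.- i) ≡ j
  cancel = solve-∀
  b+k≡b′ : b ℤ.+ + k ≡ b′
  b+k≡b′ = trans (cong (λ z → b ℤ.+ z) (ℤ.0≤i⇒+∣i∣≡i (ℤ.i≤j⇒0≤j-i b≤b′))) (cancel b b′)
  shuffle : ∀ b c i k → k ℤ.+ (b ℤ.+ c ℤ.- i) ≡ b ℤ.+ k ℤ.+ c ℤ.- i
  shuffle = solve-∀

convolve-expandˡ : ∀ f G {b b′} c i → deg f ≤ b → deg f ≤ b′ →
  at (convolve (expand f b) G) (b ℤ.+ c ℤ.- i) ≡
  at (convolve (expand f b′) G) (b′ ℤ.+ c ℤ.- i)
convolve-expandˡ f G {b} {b′} c i deg-b deg-b′ with ℤ.≤-total b b′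
... | inj₁ b≤b′ = convolve-expand-≤ f G c i deg-b b≤b′
... | inj₂ b′≤b = sym (convolve-expand-≤ f G c i deg-b′ b′≤b)

convolve-expandʳ : ∀ F g {c c′} b i → deg g ≤ c → deg g ≤ c′ →
  at (convolve F (expand g c)) (b ℤ.+ c ℤ.- i) ≡
  at (convolve F (expand g c′)) (b ℤ.+ c′ ℤ.- i)
convolve-expandʳ F g {c} {c′} b i deg-c deg-c′ = begin
  at (convolve F (expand g c)) (b ℤ.+ c ℤ.- i)   ≡⟨ swap c ⟩
  at (convolve (expand g c) F) (c ℤ.+ b ℤ.- i)   ≡⟨ convolve-expandˡ g F b i deg-c deg-c′ ⟩
  at (convolve (expand g c′) F) (c′ ℤ.+ b ℤ.- i) ≡⟨ swap c′ ⟨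
  at (convolve F (expand g c′)) (b ℤ.+ c′ ℤ.- i) ∎
  where
  open ≡-Reasoning
  swap : ∀ c → at (convolve F (expand g c)) (b ℤ.+ c ℤ.- i) ≡
               at (convolve (expand g c) F) (c ℤ.+ b ℤ.- i)
  swap c = trans (at-cong (convolve-comm F (expand g c)) (b ℤ.+ c ℤ.- i))
    (cong (λ z → at (convolve (expand g c) F) (z ℤ.- i)) (ℤ.+-comm b c))

-- This makes the product independent of the stored bounds: any bounds of the two supports will do.
-- Congruence, associativity and distributivity all rest on it.
*-represents : ∀ {f g b c F G} → Represents f b F → Represents g c G →
               Represents (f * g) (b ℤ.+ c) (convolve F G)
*-represents {f} {g} {b} {c} {F} {G} rf rg = representation λ i → begin
  coeff (f * g) i
    ≡⟨ coefficients (*-represents-bound f g) i ⟩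
  at (convolve (expand f (bound f)) (expand g (bound g))) (bound f ℤ.+ bound g ℤ.- i)
    ≡⟨ convolve-expandˡ f _ (bound g) i (vanishes f) (represents⇒deg rf) ⟩
  at (convolve (expand f b) (expand g (bound g))) (b ℤ.+ bound g ℤ.- i)
    ≡⟨ convolve-expandʳ _ g b i (vanishes g) (represents⇒deg rg) ⟩
  at (convolve (expand f b) (expand g c)) (b ℤ.+ c ℤ.- i)
    ≡⟨ at-cong (convolve-cong (represents-coeff rf) (represents-coeff rg)) (b ℤ.+ c ℤ.- i) ⟩
  at (convolve F G) (b ℤ.+ c ℤ.- i) ∎
  where open ≡-Reasoning

-- With coefficient 1 it has the coefficients of `T^_` by definition, so equations about one are
-- equations about the other.
monomialSeries : ℚ → ℤ → Laurent
monomialSeries c n = record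
  { coeff    = λ i → if does (i ℤ.≟ n) then c else 0ℚ
  ; bound    = n
  ; vanishes = vanish
  }
  where
  vanish : ∀ i → n ℤ.< i → (if does (i ℤ.≟ n) then c else 0ℚ) ≡ 0ℚ
  vanish i n<i with i ℤ.≟ n
  ... | yes i≡n = contradiction (sym i≡n) (ℤ.<⇒≢ n<i)
  ... | no  _   = refl

monomial-coeff : ∀ c n → coeff (monomialSeries c n) n ≡ c
monomial-coeff c n with n ℤ.≟ n
... | yes _  = refl
... | no n≢n = contradiction refl n≢n

monomial-vanishes : ∀ c {n i} → i ≢ n → coeff (monomialSeries c n) i ≡ 0ℚ
monomial-vanishes c {n} {i} i≢n with i ℤ.≟ n
... | yes i≡n = contradiction i≡n i≢n
... | no _    = refl

monomial-represents : ∀ c n → Represents (monomialSeries c n) n (δ c)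
monomial-represents c n = ≗⇒represents {monomialSeries c n} (vanishes (monomialSeries c n)) λ where
    zero    → trans (cong (coeff (monomialSeries c n)) (ℤ.+-identityʳ n)) (monomial-coeff c n)
    (suc k) → monomial-vanishes c {n} {n ℤ.- + suc k} (ℤ.<⇒≢ (slack< k (cancel n (+ suc k))))
  where
  cancel : ∀ n k → n ℤ.- k ℤ.+ k ≡ n
  cancel = solve-∀

-- The ring axioms

≈-refl : ∀ {f} → f ≈ f
≈-refl i = refl

≈-sym : ∀ {f g} → f ≈ g → g ≈ f
≈-sym p i = sym (p i)

≈-trans : ∀ {f g h} → f ≈ g → g ≈ h → f ≈ h
≈-trans p q i = trans (p i) (q i)

represents-resp : ∀ {f g b F} → f ≈ g → Represents f b F → Represents g b F
represents-resp f≈g rf = representation λ i → trans (sym (f≈g i)) (coefficients rf i)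

*-cong : ∀ {f f′ g g′} → f ≈ f′ → g ≈ g′ → f * g ≈ f′ * g′
*-cong {f} {f′} {g} {g′} f≈ g≈ = represents⇒≈ {f * g} {f′ * g′}
  (*-represents (bound-represents f) (bound-represents g))
  (*-represents (represents-resp {f} {f′} f≈ (bound-represents f))
                          (represents-resp {g} {g′} g≈ (bound-represents g)))
  refl λ _ → refl

*-comm : ∀ f g → f * g ≈ g * f
*-comm f g = represents⇒≈ {f * g} {g * f}
  (*-represents-bound f g) (*-represents-bound g f)
  (ℤ.+-comm (bound f) (bound g)) (convolve-comm _ _)

*-assoc : ∀ f g h → (f * g) * h ≈ f * (g * h)
*-assoc f g h = represents⇒≈ {(f * g) * h} {f * (g * h)}
  (*-represents (*-represents-bound f g) (bound-represents h))
  (*-represents (bound-represents f) (*-represents-bound g h))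
  (ℤ.+-assoc (bound f) (bound g) (bound h)) (convolve-assoc (expand f (bound f)) _ _)

+-represents : ∀ {f g b F G} → Represents f b F → Represents g b G →
               Represents (f + g) b (λ n → F n ℚ.+ G n)
+-represents {b = b} rf rg = representation λ i →
  trans (cong₂ ℚ._+_ (coefficients rf i) (coefficients rg i)) (at-+ (b ℤ.- i))
  where
  at-+ : ∀ {F G} j → at F j ℚ.+ at G j ≡ at (λ n → F n ℚ.+ G n) j
  at-+ (+ n)    = refl
  at-+ -[1+ n ] = refl

*-distribʳ-+ : ∀ h f g → (f + g) * h ≈ f * h + g * h
*-distribʳ-+ h f g = represents⇒≈ {(f + g) * h} {f * h + g * h}
  (*-represents (+-represents rf rg) rh)
  (+-represents (*-represents rf rh) (*-represents rg rh))
  refl (convolve-distribʳ _ _ _)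
  where
  b = bound f ℤ.⊔ bound g
  rf : Represents f b (expand f b)
  rf = expand-represents {f} λ i b<i → vanishes f i (ℤ.≤-<-trans (ℤ.i≤i⊔j (bound f) (bound g)) b<i)
  rg : Represents g b (expand g b)
  rg = expand-represents {g} λ i b<i → vanishes g i (ℤ.≤-<-trans (ℤ.i≤j⊔i (bound f) (bound g)) b<i)
  rh = bound-represents h

monomial-* : ∀ a b m n →
  monomialSeries a m * monomialSeries b n ≈ monomialSeries (a ℚ.* b) (m ℤ.+ n)
monomial-* a b m n = represents⇒≈
  {monomialSeries a m * monomialSeries b n} {monomialSeries (a ℚ.* b) (m ℤ.+ n)}
  (*-represents (monomial-represents a m) (monomial-represents b n))
  (monomial-represents (a ℚ.* b) (m ℤ.+ n)) refl λ where
    zero    → refl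
    (suc k) → trans (convolve-δˡ a (δ b) (suc k)) (ℚ.*-zeroʳ a)

*-identityˡ : ∀ f → monomialSeries 1ℚ (+ 0) * f ≈ f
*-identityˡ f = represents⇒≈ {monomialSeries 1ℚ (+ 0) * f} {f}
  (*-represents (monomial-represents 1ℚ (+ 0)) (bound-represents f))
  (bound-represents f) (ℤ.+-identityˡ (bound f))
  λ n → trans (convolve-δˡ 1ℚ _ n) (ℚ.*-identityˡ _)

monomial-+ : ∀ a b n → monomialSeries (a ℚ.+ b) n ≈ monomialSeries a n + monomialSeries b n
monomial-+ a b n i with i ℤ.≟ n
... | yes _ = refl
... | no  _ = refl

monomial-neg : ∀ a n → monomialSeries (ℚ.- a) n ≈ - monomialSeries a n
monomial-neg a n i with i ℤ.≟ n
... | yes _ = refl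
... | no  _ = refl

monomial-zero : ∀ n → ∀ i → coeff (monomialSeries 0ℚ n) i ≡ 0ℚ
monomial-zero n i with i ℤ.≟ n
... | yes _ = refl
... | no  _ = refl

+-cong : ∀ {f f′ g g′} → f ≈ f′ → g ≈ g′ → f + g ≈ f′ + g′
+-cong p q i = cong₂ ℚ._+_ (p i) (q i)

+-identityˡ : ∀ f → monomialSeries 0ℚ (+ 0) + f ≈ f
+-identityˡ f i = trans (cong (ℚ._+ coeff f i) (monomial-zero (+ 0) i)) (ℚ.+-identityˡ _)

+-inverseˡ : ∀ f → - f + f ≈ monomialSeries 0ℚ (+ 0)
+-inverseˡ f i = trans (ℚ.+-inverseˡ (coeff f i)) (sym (monomial-zero (+ 0) i))

isCommutativeRing :
  IsCommutativeRing _≈_ _+_ _*_ -_ (monomialSeries 0ℚ (+ 0)) (monomialSeries 1ℚ (+ 0))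
isCommutativeRing = record
    { isRing = record
      { +-isAbelianGroup = record
        { isGroup = record
          { isMonoid = record
            { isSemigroup = record
              { isMagma = record
                { isEquivalence = record
                  { refl  = λ {f} → ≈-refl {f}
                  ; sym   = λ {f} {g} → ≈-sym {f} {g}
                  ; trans = λ {f} {g} {h} → ≈-trans {f} {g} {h}
                  }
                ; ∙-cong = λ {f} {f′} {g} {g′} → +-cong {f} {f′} {g} {g′}
                }
              ; assoc = λ f g h i → ℚ.+-assoc (coeff f i) (coeff g i) (coeff h i)
              }
            ; identity = +-identityˡ , λ f → ≈-trans {f + Z} {Z + f} {f} (comm f Z) (+-identityˡ f)
            }
          ; inverse = +-inverseˡ , λ f → ≈-trans {f + - f} { - f + f} {Z} (comm f (- f)) (+-inverseˡ f)
          ; ⁻¹-cong = λ f≈g i → cong ℚ.-_ (f≈g i)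
          }
        ; comm = comm
        }
      ; *-cong = λ {f} {f′} {g} {g′} → *-cong {f} {f′} {g} {g′}
      ; *-assoc = *-assoc
      ; *-identity = *-identityˡ ,
          λ f → ≈-trans {f * I} {I * f} {f} (*-comm f I) (*-identityˡ f)
      ; distrib = (λ h f g → ≈-trans {h * (f + g)} {(f + g) * h} {h * f + h * g} (*-comm h (f + g))
            (≈-trans {(f + g) * h} {f * h + g * h} {h * f + h * g} (*-distribʳ-+ h f g)
            (+-cong {f * h} {h * f} {g * h} {h * g} (*-comm f h) (*-comm g h))))
          , *-distribʳ-+
      }
    ; *-comm = *-comm
    }
  where
  Z = monomialSeries 0ℚ (+ 0)
  I = monomialSeries 1ℚ (+ 0)
  comm : ∀ f g → f + g ≈ g + f
  comm f g i = ℚ.+-comm (coeff f i) (coeff g i)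

polynomial-* : ∀ f g → IsPolynomial f → IsPolynomial g → IsPolynomial (f * g)
polynomial-* f g pf pg n = trans
  (sum-cong-≗ {length} λ k → term (bound f ℤ.- + toℕ k))
  (sum-replicate-zero length)
  where
  length = suc ℤ.∣ -[1+ n ] ℤ.- (bound f ℤ.+ bound g) ∣
  -- The two exponents have a negative sum, so one of them is negative. Splitting `+ zero` from
  -- `+ suc j` lets the difference reduce to a negative constructor.
  term : ∀ j → coeff f j ℚ.* coeff g (-[1+ n ] ℤ.- j) ≡ 0ℚ
  term -[1+ j ]  = trans (cong (ℚ._* _) (pf j)) (ℚ.*-zeroˡ (coeff g (-[1+ n ] ℤ.- -[1+ j ])))
  term (+ zero)  = trans (cong (coeff f (+ 0) ℚ.*_) (pg n)) (ℚ.*-zeroʳ (coeff f (+ 0)))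
  term (+ suc j) = trans (cong (coeff f (+ suc j) ℚ.*_) (pg _)) (ℚ.*-zeroʳ (coeff f (+ suc j)))

-- Degrees, leading coefficients and polynomials

infix  4 _≋_ _≼_
infixl 6 _⊕_ _⊖_
infixl 7 _⊗_
infix  8 ⊝_

-- Opaque copies of the operations, which keep the type checker from comparing
-- series by unfolding their coefficients.
opaque
  _≋_ : Laurent → Laurent → Set
  f ≋ g = f ≈ g

  _≼_ : Laurent → ℤ → Set
  f ≼ n = deg f ≤ n

  Polynomial : Laurent → Set
  Polynomial = IsPolynomial

  _⊕_ _⊗_ : Laurent → Laurent → Laurent
  _⊕_ = _+_
  _⊗_ = _*_

  ⊝_ : Laurent → Laurent
  ⊝_ = -_

  monomial : ℚ → ℤ → Laurent
  monomial = monomialSeries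

-- Kept transparent, so that it agrees with `_:-_` of the ring solver, which adds a negative.
_⊖_ : Laurent → Laurent → Laurent
f ⊖ g = f ⊕ ⊝ g

const : ℚ → Laurent
const c = monomial c (+ 0)

0ᴸ 1ᴸ 2ᴸ : Laurent
0ᴸ = const 0ℚ
1ᴸ = const 1ℚ
2ᴸ = const (1ℚ ℚ.+ 1ℚ)

opaque
  unfolding _≋_ _≼_ Polynomial _⊕_ _⊗_ ⊝_ monomial

  ⊕-⊗-isCommutativeRing : IsCommutativeRing _≋_ _⊕_ _⊗_ ⊝_ 0ᴸ 1ᴸ
  ⊕-⊗-isCommutativeRing = isCommutativeRing

  monomial-⊗ : ∀ a b m n → monomial a m ⊗ monomial b n ≋ monomial (a ℚ.* b) (m ℤ.+ n)
  monomial-⊗ = monomial-*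

  monomial-⊕ : ∀ a b n → monomial (a ℚ.+ b) n ≋ monomial a n ⊕ monomial b n
  monomial-⊕ = monomial-+

  monomial-⊝ : ∀ a n → monomial (ℚ.- a) n ≋ ⊝ monomial a n
  monomial-⊝ = monomial-neg

  ≼-resp : ∀ {f g n} → f ≋ g → f ≼ n → g ≼ n
  ≼-resp f≈g deg-f i n<i = trans (sym (f≈g i)) (deg-f i n<i)

  ≼-mono : ∀ {f m n} → m ℤ.≤ n → f ≼ m → f ≼ n
  ≼-mono m≤n deg-f i n<i = deg-f i (ℤ.≤-<-trans m≤n n<i)

  ≼-⊕ : ∀ {f g n} → f ≼ n → g ≼ n → f ⊕ g ≼ n
  ≼-⊕ deg-f deg-g i n<i = cong₂ ℚ._+_ (deg-f i n<i) (deg-g i n<i)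

  ≼-⊝ : ∀ {f n} → f ≼ n → ⊝ f ≼ n
  ≼-⊝ deg-f i n<i = cong ℚ.-_ (deg-f i n<i)

  ≼-⊗ : ∀ {f g m n} → f ≼ m → g ≼ n → f ⊗ g ≼ m ℤ.+ n
  ≼-⊗ {f} {g} deg-f deg-g = represents⇒deg
    (*-represents (expand-represents {f} deg-f) (expand-represents {g} deg-g))

  ≼-monomial : ∀ {c n} → monomial c n ≼ n
  ≼-monomial {c} {n} = vanishes (monomialSeries c n)

-- f = a Tⁿ + lower terms, where a may be zero.
record Leading (f : Laurent) (n : ℤ) (a : ℚ) : Set where
  constructor _,_
  field
    degree      : f ≼ n
    coefficient : coeff f n ≡ a

open Leading

opaque
  unfolding _≋_ _≼_ Polynomial _⊕_ _⊗_ ⊝_ monomial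

  leading-resp : ∀ {f g n a} → f ≋ g → Leading f n a → Leading g n a
  leading-resp {f} {g} {n} f≈g (deg-f , eq) = ≼-resp {f} {g} f≈g deg-f , trans (sym (f≈g n)) eq

  leading-monomial : ∀ c n → Leading (monomial c n) n c
  leading-monomial c n = ≼-monomial {c} , monomial-coeff c n

  leading-⊕ : ∀ {f g n a b} → Leading f n a → Leading g n b → Leading (f ⊕ g) n (a ℚ.+ b)
  leading-⊕ {f} {g} (deg-f , eq-f) (deg-g , eq-g) = ≼-⊕ {f} {g} deg-f deg-g , cong₂ ℚ._+_ eq-f eq-g

  leading-⊝ : ∀ {f n a} → Leading f n a → Leading (⊝ f) n (ℚ.- a)
  leading-⊝ {f} (deg-f , eq) = ≼-⊝ {f} deg-f , cong ℚ.-_ eq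

  leading-⊗ : ∀ {f g m n a b} → Leading f m a → Leading g n b →
              Leading (f ⊗ g) (m ℤ.+ n) (a ℚ.* b)
  leading-⊗ {f} {g} {m} {n} (deg-f , eq-f) (deg-g , eq-g) =
    ≼-⊗ {f} {g} deg-f deg-g , trans
      (represents-leading (*-represents (expand-represents {f} deg-f) (expand-represents {g} deg-g)))
      (cong₂ ℚ._*_ (trans (cong (coeff f) (ℤ.+-identityʳ m)) eq-f)
                   (trans (cong (coeff g) (ℤ.+-identityʳ n)) eq-g))

  -- Lets a summand of lower degree enter `leading-⊕` without changing the leading coefficient.
  ≼∧<⇒leading-zero : ∀ {f m n} → f ≼ m → m ℤ.< n → Leading f n 0ℚ
  ≼∧<⇒leading-zero {f} deg-f m<n = ≼-mono {f} (ℤ.<⇒≤ m<n) deg-f , deg-f _ m<n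

  -- Turns the cancellation of leading terms into a drop of the degree; `inverse` uses it for 1 -
  -- ug.
  leading-zero⇒≼ : ∀ {f n} → Leading f (ℤ.suc n) 0ℚ → f ≼ n
  leading-zero⇒≼ {f} {n} (deg-f , eq) i n<i with i ℤ.≟ ℤ.suc n
  ... | yes refl = eq
  ... | no  i≢1+n = deg-f i (ℤ.≤∧≢⇒< (ℤ.i<j⇒suc[i]≤j n<i) (i≢1+n ∘ sym))

  ≋0⇒coeff : ∀ {f} → f ≋ 0ᴸ → ∀ i → coeff f i ≡ 0ℚ
  ≋0⇒coeff f≈0 i = trans (f≈0 i) (monomial-zero (+ 0) i)

  polynomial-resp : ∀ {f g} → f ≋ g → Polynomial f → Polynomial g
  polynomial-resp f≈g pf n = trans (sym (f≈g -[1+ n ])) (pf n)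

  polynomial-monomial : ∀ c n → Polynomial (monomial c (+ n))
  polynomial-monomial c n k = refl

  polynomial-⊕ : ∀ {f g} → Polynomial f → Polynomial g → Polynomial (f ⊕ g)
  polynomial-⊕ pf pg n = cong₂ ℚ._+_ (pf n) (pg n)

  polynomial-⊝ : ∀ {f} → Polynomial f → Polynomial (⊝ f)
  polynomial-⊝ pf n = cong ℚ.-_ (pf n)

  polynomial-⊗ : ∀ {f g} → Polynomial f → Polynomial g → Polynomial (f ⊗ g)
  polynomial-⊗ {f} {g} = polynomial-* f g

  polynomial-degree<0 : ∀ {f n} → Polynomial f → f ≼ n → n ℤ.< + 0 → f ≋ 0ᴸ
  polynomial-degree<0 pf deg-f n<0 (+ i)    =
    trans (deg-f (+ i) (ℤ.<-≤-trans n<0 (ℤ.+≤+ ℕ.z≤n))) (sym (monomial-zero (+ 0) (+ i)))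
  polynomial-degree<0 pf deg-f n<0 -[1+ i ] = trans (pf i) (sym (monomial-zero (+ 0) -[1+ i ]))

  polynomial-degree≥0 : ∀ {f n} → Polynomial f → coeff f n ≢ 0ℚ → + 0 ℤ.≤ n
  polynomial-degree≥0 {n = + n}      pf _       = ℤ.+≤+ ℕ.z≤n
  polynomial-degree≥0 {n = -[1+ n ]} pf coeff≢0 = contradiction (pf n) coeff≢0

  ⌊⌋-cong : ∀ {f g} → f ≋ g → ⌊ f ⌋ ≋ ⌊ g ⌋
  ⌊⌋-cong f≈g (+ n)    = f≈g (+ n)
  ⌊⌋-cong f≈g -[1+ n ] = refl

  coeff-difference : ∀ f g i → coeff (f ⊖ g) i ≡ 0ℚ → coeff f i ≡ coeff g i
  coeff-difference f g i = x∙y⁻¹≈ε⇒x≈y (coeff f i) (coeff g i)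
    where open GroupProperties ℚ.+-0-group using (x∙y⁻¹≈ε⇒x≈y)

  ⌊⌋-unique : ∀ {f g} → Polynomial g → f ⊖ g ≼ -[1+ 0 ] → ⌊ f ⌋ ≋ g
  ⌊⌋-unique {f} {g} pg deg-f-g (+ n)    = coeff-difference f g (+ n) (deg-f-g (+ n) ℤ.-<+)
  ⌊⌋-unique         pg deg-f-g -[1+ n ] = sym (pg n)

-- Banach's fixed point theorem in the complete space of series of negative degree.
module FixedPoint
  (Φ : Laurent → Laurent)
  (Φ-degree : ∀ {x} → x ≼ -[1+ 0 ] → Φ x ≼ -[1+ 0 ])
  (Φ-contracts : ∀ {x y n} → x ≼ -[1+ 0 ] → y ≼ -[1+ 0 ] →
                 x ⊖ y ≼ -[1+ n ] → Φ x ⊖ Φ y ≼ -[1+ suc n ])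
  where

  iterate : ℕ → Laurent
  iterate zero    = 0ᴸ
  iterate (suc n) = Φ (iterate n)

  opaque
    unfolding _≋_ _≼_ Polynomial _⊕_ _⊗_ ⊝_ monomial

    iterate-degree : ∀ n → iterate n ≼ -[1+ 0 ]
    iterate-degree zero    i _ = monomial-zero (+ 0) i
    iterate-degree (suc n) = Φ-degree (iterate-degree n)

    iterate-step : ∀ n → iterate (suc n) ⊖ iterate n ≼ -[1+ n ]
    iterate-step zero    = ≼-⊕ {iterate 1} {⊝ iterate 0}
      (iterate-degree 1) (≼-⊝ {iterate 0} (iterate-degree 0))
    iterate-step (suc n) = Φ-contracts (iterate-degree (suc n)) (iterate-degree n) (iterate-step n)

    limit : Laurent
    limit = record { coeff = c ; bound = -[1+ 0 ] ; vanishes = c-vanishes }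
      where
      c : ℤ → ℚ
      c (+ _)    = 0ℚ
      -- From iterate `suc n` on, all steps have degree at most `-[1+ suc n ]`, so this coefficient
      -- has its final value.
      c -[1+ n ] = coeff (iterate (suc n)) -[1+ n ]

      c-vanishes : ∀ i → -[1+ 0 ] ℤ.< i → c i ≡ 0ℚ
      c-vanishes (+ _)    _          = refl
      c-vanishes -[1+ n ] (ℤ.-<- ())

    iterate-stable : ∀ j k → coeff (iterate (suc j ℕ.+ k)) -[1+ j ] ≡ coeff limit -[1+ j ]
    iterate-stable j zero    = cong (λ n → coeff (iterate (suc n)) -[1+ j ]) (ℕ.+-identityʳ j)
    iterate-stable j (suc k) = trans
      (cong (λ n → coeff (iterate (suc n)) -[1+ j ]) (ℕ.+-suc j k))
      (trans (coeff-difference (iterate (suc n)) (iterate n) -[1+ j ]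
               (iterate-step n -[1+ j ] (ℤ.-<- (ℕ.m≤m+n (suc j) k))))
             (iterate-stable j k))
      where
      n : ℕ
      n = suc j ℕ.+ k

    limit-iterate : ∀ n → limit ⊖ iterate n ≼ -[1+ n ]
    limit-iterate n (+ i) _ = cong (λ c → 0ℚ ℚ.- c) (iterate-degree n (+ i) ℤ.-<+)
    limit-iterate n -[1+ j ] (ℤ.-<- j<n) =
      trans (cong (ℚ._- coeff (iterate n) -[1+ j ])
              (trans (sym (iterate-stable j (n ℕ.∸ suc j)))
                     (cong (λ m → coeff (iterate m) -[1+ j ]) (ℕ.m+[n∸m]≡n j<n))))
            (ℚ.+-inverseʳ (coeff (iterate n) -[1+ j ]))

    limit-degree : limit ≼ -[1+ 0 ]
    limit-degree = vanishes limit

    limit-fixed : limit ≋ Φ limit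
    limit-fixed (+ i)    = sym (Φ-degree limit-degree (+ i) ℤ.-<+)
    -- `Φ (iterate j)` is `iterate (suc j)`, whose coefficient at this place is that of `limit` by
    -- definition, and `Φ` lowers the degree of `limit ⊖ iterate j` below this place.
    limit-fixed -[1+ j ] = sym (coeff-difference (Φ limit) (Φ (iterate j)) -[1+ j ]
      (Φ-contracts limit-degree (iterate-degree j) (limit-iterate j)
        -[1+ j ] (ℤ.-<- ℕ.≤-refl)))

-- Ring solver, inverses and square roots

laurentRing : CommutativeRing 0ℓ 0ℓ
laurentRing = record { isCommutativeRing = ⊕-⊗-isCommutativeRing }

open CommutativeRing laurentRing
  using (setoid)
  renaming
    ( refl to ≋-refl; sym to ≋-sym; trans to ≋-trans; +-cong to ⊕-cong
    ; *-cong to ⊗-cong; -‿cong to ⊝-cong; *-comm to ⊗-comm; *-identityˡ to ⊗-identityˡ; zeroˡ to ⊗-zeroˡ)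

-- The solver takes its coefficients from ℚ, where equality is decidable; so it also normalises
-- identities with the constants 2, 1/2 and -1/4.
const-homomorphism : ℚ.+-*-rawRing -Raw-AlmostCommutative⟶ fromCommutativeRing laurentRing
const-homomorphism = record
  { ⟦_⟧    = const
  ; +-homo = λ a b → monomial-⊕ a b (+ 0)
  ; *-homo = λ a b → ≋-sym (monomial-⊗ a b (+ 0) (+ 0))
  ; -‿homo = λ a → monomial-⊝ a (+ 0)
  ; 0-homo = ≋-refl
  ; 1-homo = ≋-refl
  }

const-≋? : ∀ a b → Maybe (const a ≋ const b)
const-≋? a b with a ℚ.≟ b
... | yes refl = just ≋-refl
... | no  _    = nothing

open Algebra.Solver.Ring ℚ.+-*-rawRing (fromCommutativeRing laurentRing)
  const-homomorphism const-≋?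
  using (solve; _:=_; _:+_; _:*_; _:-_; :-_; con)

module ≋-Reasoning = SetoidReasoning setoid

-- To prove x ≋ y given u ≋ v, exhibit x − y as a multiple of u − v.
modulo : ∀ {x u v} y z → u ≋ v → x ≋ y ⊕ z ⊗ (u ⊖ v) → x ≋ y
modulo {x} {u} {v} y z u≋v x≋ = begin
  x               ≈⟨ x≋ ⟩
  y ⊕ z ⊗ (u ⊖ v) ≈⟨ ⊕-cong ≋-refl (⊗-cong ≋-refl (⊕-cong u≋v ≋-refl)) ⟩
  y ⊕ z ⊗ (v ⊖ v) ≈⟨ solve 3 (λ y z v → y :+ z :* (v :- v) := y) ≋-refl y z v ⟩
  y               ∎
  where open ≋-Reasoning

≼-1⊕ : ∀ {y} → y ≼ -[1+ 0 ] → 1ᴸ ⊕ y ≼ + 0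
≼-1⊕ y≼-1 = ≼-⊕ ≼-monomial (≼-mono ℤ.-≤+ y≼-1)

-- `1 + y` is the sum of the powers of w, obtained from the equation y = w (1 + y); multiplication
-- by w contracts because w has negative degree.
geometric-series : ∀ {w} → w ≼ -[1+ 0 ] →
  ∃[ y ] y ≼ -[1+ 0 ] × (1ᴸ ⊖ w) ⊗ (1ᴸ ⊕ y) ≋ 1ᴸ
geometric-series {w} w≼-1 = limit , limit-degree ,
  modulo 1ᴸ 1ᴸ limit-fixed
    (solve 2 (λ w y → (con 1ℚ :- w) :* (con 1ℚ :+ y)
                   := con 1ℚ :+ con 1ℚ :* (y :- w :* (con 1ℚ :+ y))) ≋-refl w limit)
  where
  open FixedPoint (λ y → w ⊗ (1ᴸ ⊕ y))
    (λ y≼-1 → ≼-⊗ w≼-1 (≼-1⊕ y≼-1))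
    (λ {x} {y} _ _ x-y≼ → ≼-resp
      (solve 3 (λ w x y → w :* (x :- y)
                       := w :* (con 1ℚ :+ x) :- w :* (con 1ℚ :+ y)) ≋-refl w x y)
      (≼-⊗ w≼-1 x-y≼))

-- Writing the root as 1 + 2z, the equation becomes z = v − z².
square-root-1+4v : ∀ {v} → v ≼ -[1+ 0 ] →
  ∃[ y ] y ≼ -[1+ 0 ] × (1ᴸ ⊕ y) ⊗ (1ᴸ ⊕ y) ≋ 1ᴸ ⊕ 2ᴸ ⊗ (2ᴸ ⊗ v)
square-root-1+4v {v} v≼-1 = 2ᴸ ⊗ limit , ≼-⊗ ≼-monomial limit-degree ,
  modulo (1ᴸ ⊕ 2ᴸ ⊗ (2ᴸ ⊗ v)) (2ᴸ ⊗ 2ᴸ) limit-fixed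
    (solve 2 (λ v z → let one = con 1ℚ ; two = con (1ℚ ℚ.+ 1ℚ) in
                      (one :+ two :* z) :* (one :+ two :* z)
                   := one :+ two :* (two :* v) :+ two :* two :* (z :- (v :- z :* z)))
       ≋-refl v limit)
  where
  open FixedPoint (λ z → v ⊖ z ⊗ z)
    (λ z≼-1 → ≼-⊕ v≼-1 (≼-⊝ (≼-mono (ℤ.-≤- ℕ.z≤n) (≼-⊗ z≼-1 z≼-1))))
    -- The values differ by -(x + y)(x - y), and x + y has negative degree; this is where the
    -- contraction is confined to series of negative degree.
    (λ {x} {y} x≼-1 y≼-1 x-y≼ → ≼-resp
      (solve 3 (λ v x y → :- ((x :+ y) :* (x :- y)) := v :- x :* x :- (v :- y :* y))
         ≋-refl v x y)
      (≼-⊝ (≼-⊗ (≼-⊕ x≼-1 y≼-1) x-y≼)))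

*-≢0 : ∀ {a b} → a ≢ 0ℚ → b ≢ 0ℚ → a ℚ.* b ≢ 0ℚ
*-≢0 {a} {b} a≢0 b≢0 ab≡0 = a≢0 (begin
  a                      ≡⟨ ℚ.*-identityʳ a ⟨
  a ℚ.* 1ℚ               ≡⟨ cong (a ℚ.*_) (ℚ.*-inverseʳ b) ⟨
  a ℚ.* (b ℚ.* ℚ.1/ b)   ≡⟨ ℚ.*-assoc a b _ ⟨
  a ℚ.* b ℚ.* ℚ.1/ b     ≡⟨ cong (ℚ._* ℚ.1/ b) ab≡0 ⟩
  0ℚ ℚ.* ℚ.1/ b          ≡⟨ ℚ.*-zeroˡ (ℚ.1/ b) ⟩
  0ℚ                     ∎)
  where
  open ≡-Reasoning
  instance _ = ℚ.≢-nonZero b≢0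

-- With u = T⁻ⁿ/a the product ug is 1 - w for some w of negative degree, so the geometric series
-- inverts it.
inverse : ∀ {g n a} → Leading g n a → a ≢ 0ℚ → ∃[ h ] g ⊗ h ≋ 1ᴸ × h ≼ ℤ.- n
inverse {g} {n} {a} g-leading a≢0 =
  let y , y≼-1 , eq = geometric-series w≼-1 in
  u ⊗ (1ᴸ ⊕ y) ,
  ≋-trans (solve 3 (λ g u y → g :* (u :* (con 1ℚ :+ y))
                           := (con 1ℚ :- (con 1ℚ :- u :* g)) :* (con 1ℚ :+ y)) ≋-refl g u y) eq ,
  subst (u ⊗ (1ᴸ ⊕ y) ≼_) (ℤ.+-identityʳ (ℤ.- n)) (≼-⊗ ≼-monomial (≼-1⊕ y≼-1))
  where
  instance _ = ℚ.≢-nonZero a≢0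
  u w : Laurent
  u = monomial (ℚ.1/ a) (ℤ.- n)
  w = 1ᴸ ⊖ u ⊗ g

  w-leading : Leading w (+ 0) (1ℚ ℚ.- ℚ.1/ a ℚ.* a)
  w-leading = leading-⊕ (leading-monomial 1ℚ (+ 0)) (leading-⊝
    (subst (λ i → Leading (u ⊗ g) i _) (ℤ.+-inverseˡ n)
      (leading-⊗ (leading-monomial (ℚ.1/ a) (ℤ.- n)) g-leading)))

  w≼-1 : w ≼ -[1+ 0 ]
  w≼-1 = leading-zero⇒≼ (subst (λ c → Leading w (+ 0) (1ℚ ℚ.- c)) (ℚ.*-inverseˡ a) w-leading)

divide : ∀ {f g h p} → g ⊗ h ≋ 1ᴸ → f ⊗ g ≋ p → f ≋ p ⊗ h
divide {f} {g} {h} {p} gh≋1 fg≋p = ≋-trans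
  (modulo (f ⊗ g ⊗ h) f (≋-sym gh≋1)
    (solve 3 (λ f g h → f := f :* g :* h :+ f :* (con 1ℚ :- g :* h)) ≋-refl f g h))
  (⊗-cong fg≋p ≋-refl)

-- The absence of zero divisors in constructive form: the cancelled factor has a known nonzero
-- leading coefficient, hence an inverse.
⊗-cancel-≋0 : ∀ {f g n a} → Leading g n a → a ≢ 0ℚ → f ⊗ g ≋ 0ᴸ → f ≋ 0ᴸ
⊗-cancel-≋0 g-leading a≢0 fg≋0 =
  let h , gh≋1 , _ = inverse g-leading a≢0 in ≋-trans (divide gh≋1 fg≋0) (⊗-zeroˡ h)

inverse-unique : ∀ {x y z} → x ⊗ z ≋ 1ᴸ → y ⊗ z ≋ 1ᴸ → x ≋ y
inverse-unique {x} {y} {z} xz≋1 yz≋1 =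
  ≋-trans (divide (≋-trans (⊗-comm z y) yz≋1) xz≋1) (⊗-identityˡ y)

-- Continued fractions

module _ (α : Laurent) (γ b : ℕ → Laurent)
  (γ-zero : γ 0 ≋ α)
  (b-polynomial : ∀ h → Polynomial (b h))
  (fractional-part : ∀ h → γ h ⊖ b h ≼ -[1+ 0 ])
  (γ-suc : ∀ h → γ (suc h) ⊗ (γ h ⊖ b h) ≋ 1ᴸ)
  where

  ⌊γ⌋≋b : ∀ h → ⌊ γ h ⌋ ≋ b h
  ⌊γ⌋≋b h = ⌊⌋-unique (b-polynomial h) (fractional-part h)

  opaque
    unfolding _≋_ _⊕_ _⊗_ ⊝_ monomial

    isContinuedFraction : IsContinuedFraction α b
    isContinuedFraction = record
      { complete      = γ
      ; complete-zero = γ-zero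
      ; partial       = λ h i → sym (⌊γ⌋≋b h i)
      ; complete-suc  = γ-suc
      }

  module _ {a : ℕ → Laurent} (cf : IsContinuedFraction α a) where
    open IsContinuedFraction cf

    opaque
      unfolding _≋_ _⊕_ _⊗_ ⊝_ monomial

      complete-zero′ : complete 0 ≋ α
      complete-zero′ = complete-zero

      partial′ : ∀ h → a h ≋ ⌊ complete h ⌋
      partial′ = partial

      complete-suc′ : ∀ h → complete (suc h) ⊗ (complete h ⊖ a h) ≋ 1ᴸ
      complete-suc′ = complete-suc

    partial≋b : ∀ h → complete h ≋ γ h → a h ≋ b h
    partial≋b h eq = ≋-trans (partial′ h) (≋-trans (⌊⌋-cong eq) (⌊γ⌋≋b h))

    -- `The` asks about every expansion, so an arbitrary one is compared with the explicit `γ`. By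
    -- induction `complete (suc h)` and `γ (suc h)` are inverse to the same series, and inverses are
    -- unique.
    complete≋γ : ∀ h → complete h ≋ γ h
    complete≋γ zero    = ≋-trans complete-zero′ (≋-sym γ-zero)
    complete≋γ (suc h) = inverse-unique
      (≋-trans (⊗-cong ≋-refl (≋-sym (⊕-cong (complete≋γ h) (⊝-cong (partial≋b h (complete≋γ h))))))
               (complete-suc′ h))
      (γ-suc h)

    continuedFraction-unique : ∀ h → a h ≋ b h
    continuedFraction-unique h = partial≋b h (complete≋γ h)

-- Pell equations and Lagrange constants

-- By the norm equation p - qs and p + qs are inverse to each other; `remainder` fixes the first as
-- the small one, so that p/q approximates s and not -s.
record PellSolution (s : Laurent) (d m : ℕ) : Set where
  field
    p q          : Laurent
    p-polynomial : Polynomial p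
    q-polynomial : Polynomial q
    q-degree     : q ≼ + m
    q-leading≢0  : coeff q (+ m) ≢ 0ℚ
    norm         : p ⊗ p ⊖ s ⊗ s ⊗ (q ⊗ q) ≋ 1ᴸ
    remainder    : p ⊖ q ⊗ s ≼ ℤ.- + (m ℕ.+ d)

2≢0 : 1ℚ ℚ.+ 1ℚ ≢ 0ℚ
2≢0 ()

-- p′ − q′s = (p − qs)², and likewise for the conjugates.
square : ∀ {s d m} → Leading s (+ suc d) 1ℚ → Polynomial (s ⊗ s) →
  PellSolution s (suc d) m → PellSolution s (suc d) (m ℕ.+ suc d ℕ.+ m)
square {s} {d} {m} s-leading s²-polynomial pell = record
  { p = p′
  ; q = q′
  ; p-polynomial = polynomial-⊕ (polynomial-⊗ p-polynomial p-polynomial)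
      (polynomial-⊗ s²-polynomial (polynomial-⊗ q-polynomial q-polynomial))
  ; q-polynomial = polynomial-⊗ (polynomial-monomial _ 0) (polynomial-⊗ p-polynomial q-polynomial)
  ; q-degree = degree q′-leading
  ; q-leading≢0 = λ eq →
      *-≢0 2≢0 (*-≢0 p-leading≢0 q-leading≢0) (trans (sym (coefficient q′-leading)) eq)
  ; norm = begin
      p′ ⊗ p′ ⊖ s ⊗ s ⊗ (q′ ⊗ q′)
        ≈⟨ solve 3 (λ p q s → let n = p :* p :+ s :* s :* (q :* q)
                                  r = con (1ℚ ℚ.+ 1ℚ) :* (p :* q) in
             n :* n :- s :* s :* (r :* r)
             := (p :* p :- s :* s :* (q :* q)) :* (p :* p :- s :* s :* (q :* q)))
             ≋-refl p q s ⟩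
      N ⊗ N
        ≈⟨ ⊗-cong norm norm ⟩
      1ᴸ ⊗ 1ᴸ
        ≈⟨ ⊗-identityˡ 1ᴸ ⟩
      1ᴸ ∎
  ; remainder = ≼-resp
      (solve 3 (λ p q s → (p :- q :* s) :* (p :- q :* s)
           := p :* p :+ s :* s :* (q :* q) :- con (1ℚ ℚ.+ 1ℚ) :* (p :* q) :* s)
         ≋-refl p q s)
      (subst (f ⊗ f ≼_) (remainder-degree (+ m) (+ suc d)) (≼-⊗ remainder remainder))
  }
  where
  open PellSolution pell
  open ≋-Reasoning
  p′ q′ f N : Laurent
  p′ = p ⊗ p ⊕ s ⊗ s ⊗ (q ⊗ q)
  q′ = 2ᴸ ⊗ (p ⊗ q)
  f  = p ⊖ q ⊗ s
  N  = p ⊗ p ⊖ s ⊗ s ⊗ (q ⊗ q)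

  q₀ p₀ : ℚ
  q₀ = coeff q (+ m)
  -- The unsimplified leading coefficient of (p - qs) + qs, to which p - qs, being of lower degree,
  -- contributes 0.
  p₀ = 0ℚ ℚ.+ q₀ ℚ.* 1ℚ

  p-leading≢0 : p₀ ≢ 0ℚ
  p-leading≢0 = q-leading≢0 ∘ trans (sym (trans (ℚ.+-identityˡ _) (ℚ.*-identityʳ q₀)))

  -x<x : ℤ.- + (m ℕ.+ suc d) ℤ.< + (m ℕ.+ suc d)
  -x<x = slack< (m ℕ.+ suc d ℕ.+ (m ℕ.+ d)) (eq (+ m) (+ d))
    where
    eq : ∀ m d → ℤ.- (m ℤ.+ (ℤ.1ℤ ℤ.+ d)) ℤ.+ (ℤ.1ℤ ℤ.+ (m ℤ.+ (ℤ.1ℤ ℤ.+ d) ℤ.+ (m ℤ.+ d)))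
               ≡ m ℤ.+ (ℤ.1ℤ ℤ.+ d)
    eq = solve-∀

  q-leading : Leading q (+ m) q₀
  q-leading = q-degree , refl

  p-leading : Leading p (+ (m ℕ.+ suc d)) p₀
  p-leading = leading-resp
    (solve 3 (λ p q s → p :- q :* s :+ q :* s := p) ≋-refl p q s)
    (leading-⊕ (≼∧<⇒leading-zero remainder -x<x) (leading-⊗ q-leading s-leading))

  q′-leading : Leading q′ (+ (m ℕ.+ suc d ℕ.+ m)) ((1ℚ ℚ.+ 1ℚ) ℚ.* (p₀ ℚ.* q₀))
  q′-leading = leading-⊗ (leading-monomial (1ℚ ℚ.+ 1ℚ) (+ 0)) (leading-⊗ p-leading q-leading)

  remainder-degree : ∀ m d → ℤ.- (m ℤ.+ d) ℤ.+ (ℤ.- (m ℤ.+ d)) ≡ ℤ.- (m ℤ.+ d ℤ.+ m ℤ.+ d)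
  remainder-degree = solve-∀

-- Each squaring more than doubles the degree of q, so N squarings push it beyond N; the form
-- `suc (N + o)` carries this inequality.
unbounded : ∀ {s d k} → Leading s (+ suc d) 1ℚ → Polynomial (s ⊗ s) →
  PellSolution s (suc d) (suc k) → ∀ N → ∃[ o ] PellSolution s (suc d) (suc (N ℕ.+ o))
unbounded {k = k} s-leading s²-polynomial pell zero = k , pell
unbounded {s} {d} s-leading s²-polynomial pell (suc N) =
  let o , pell′ = unbounded s-leading s²-polynomial pell N in
  o ℕ.+ d ℕ.+ suc (N ℕ.+ o) ,
  subst (PellSolution s (suc d)) (cong suc (eq N o d)) (square s-leading s²-polynomial pell′)
  where
  eq : ∀ N o d → N ℕ.+ o ℕ.+ suc d ℕ.+ suc (N ℕ.+ o) ≡ suc (N ℕ.+ (o ℕ.+ d ℕ.+ suc (N ℕ.+ o)))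
  eq = ℕSolver.solve-∀

module _ {s : Laurent} {d : ℕ}
  (s-leading : Leading s (+ suc d) 1ℚ)
  (s²-polynomial : Polynomial (s ⊗ s))
  (pell : ∀ N → ∃[ o ] PellSolution s (suc d) (suc (N ℕ.+ o)))
  where

  opaque
    unfolding _≋_ _≼_ Polynomial _⊗_

    fraction-p-polynomial : ∀ x → Polynomial (Fraction.p x)
    fraction-p-polynomial = Fraction.p-polynomial

    fraction-q-polynomial : ∀ x → Polynomial (Fraction.q x)
    fraction-q-polynomial = Fraction.q-polynomial

    fraction-q-leading : ∀ x →
      Leading (Fraction.q x) (Fraction.deg-q x) (coeff (Fraction.q x) (Fraction.deg-q x))
    fraction-q-leading x = proj₁ (Fraction.q-degree x) , refl

    fraction-quotient : ∀ x → Fraction.p/q x ⊗ Fraction.q x ≋ Fraction.p x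
    fraction-quotient = Fraction.p/q-quotient

  degree-ℕ : Fraction → ℕ
  degree-ℕ x = ℤ.∣ Fraction.deg-q x ∣

  degree≥0 : ∀ x → + 0 ℤ.≤ Fraction.deg-q x
  degree≥0 x = polynomial-degree≥0 (fraction-q-polynomial x) (proj₂ (Fraction.q-degree x))

  fraction-q≼ : ∀ x → Fraction.q x ≼ + degree-ℕ x
  fraction-q≼ x = ≼-mono (ℤ.≤-reflexive (sym (ℤ.0≤i⇒+∣i∣≡i (degree≥0 x))))
    (degree (fraction-q-leading x))

  q≉0 : ∀ x → ¬ Fraction.q x ≋ 0ᴸ
  q≉0 x q≋0 = proj₂ (Fraction.q-degree x) (≋0⇒coeff q≋0 _)

  degree-exceeded : ∀ N o e → + N ℤ.+ (ℤ.- + (suc (N ℕ.+ o) ℕ.+ e)) ℤ.< + 0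
  degree-exceeded N o e = slack< (o ℕ.+ e) (eq (+ N) (+ o) (+ e))
    where
    eq : ∀ N o e → N ℤ.+ ℤ.- (ℤ.1ℤ ℤ.+ (N ℤ.+ o) ℤ.+ e) ℤ.+ (ℤ.1ℤ ℤ.+ (o ℤ.+ e)) ≡ + 0
    eq = solve-∀

  -- For a Pell solution P, Q of large degree, q (P − Qs) would be a polynomial
  -- of negative degree.
  irrational : ∀ x → ¬ Fraction.p/q x ≋ s
  irrational x r≋s = q≉0 x (begin
    q
      -- Multiplying q by P² - s²Q² = 1 displays it as a multiple of z, so z = 0 forces q = 0.
      ≈⟨ modulo (z ⊗ (P ⊕ Q ⊗ s)) q (≋-sym norm)
           (solve 4 (λ q P Q s → q := q :* (P :- Q :* s) :* (P :+ Q :* s)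
                :+ q :* (con 1ℚ :- (P :* P :- s :* s :* (Q :* Q)))) ≋-refl q P Q s) ⟩
    z ⊗ (P ⊕ Q ⊗ s)
      ≈⟨ ⊗-cong z≋0 ≋-refl ⟩
    0ᴸ ⊗ (P ⊕ Q ⊗ s)
      ≈⟨ ⊗-zeroˡ _ ⟩
    0ᴸ ∎)
    where
    open ≋-Reasoning
    open Fraction x using (p; q; p/q)
    o : ℕ
    o = proj₁ (pell (degree-ℕ x))
    open PellSolution (proj₂ (pell (degree-ℕ x)))
      renaming (p to P; q to Q; p-polynomial to P-polynomial; q-polynomial to Q-polynomial)
    z : Laurent
    z = q ⊗ (P ⊖ Q ⊗ s)

    z≋Pq-Qp : z ≋ P ⊗ q ⊖ Q ⊗ p
    z≋Pq-Qp = begin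
      q ⊗ (P ⊖ Q ⊗ s)
        ≈⟨ solve 4 (λ q P Q s → q :* (P :- Q :* s) := P :* q :- Q :* (s :* q)) ≋-refl q P Q s ⟩
      P ⊗ q ⊖ Q ⊗ (s ⊗ q)
        ≈⟨ ⊕-cong ≋-refl (⊝-cong (⊗-cong ≋-refl (⊗-cong (≋-sym r≋s) ≋-refl))) ⟩
      P ⊗ q ⊖ Q ⊗ (p/q ⊗ q)
        ≈⟨ ⊕-cong ≋-refl (⊝-cong (⊗-cong ≋-refl (fraction-quotient x))) ⟩
      P ⊗ q ⊖ Q ⊗ p ∎

    z≋0 : z ≋ 0ᴸ
    z≋0 = polynomial-degree<0
      (polynomial-resp (≋-sym z≋Pq-Qp)
        (polynomial-⊕ (polynomial-⊗ P-polynomial (fraction-q-polynomial x))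
          (polynomial-⊝ (polynomial-⊗ Q-polynomial (fraction-p-polynomial x)))))
      (≼-⊗ (fraction-q≼ x) remainder)
      (degree-exceeded (degree-ℕ x) o (suc d))

  -- The polynomial q²s² − p² = q² (s − p/q) (s + p/q) would have negative degree.
  approximation-bounded : ∀ {k} x →
    s ⊖ Fraction.p/q x ≼ ℤ.- (+ 2 ℤ.* Fraction.deg-q x) ℤ.- k → ¬ + suc d ℤ.< k
  approximation-bounded {k} x close d<k = irrational x (begin
    p/q             ≈⟨ solve 2 (λ r s → r := s :- (s :- r)) ≋-refl p/q s ⟩
    s ⊖ (s ⊖ p/q)   ≈⟨ ⊕-cong ≋-refl (⊝-cong s-r≋0) ⟩
    s ⊖ 0ᴸ          ≈⟨ solve 1 (λ s → s :- con 0ℚ := s) ≋-refl s ⟩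
    s               ∎)
    where
    open ≋-Reasoning
    open Fraction x using (p; q; p/q; deg-q)
    r z : Laurent
    r = p/q
    z = (s ⊖ r) ⊗ (s ⊕ r) ⊗ q ⊗ q

    close<d : ℤ.- (+ 2 ℤ.* deg-q) ℤ.- k ℤ.< + suc d
    close<d = ℤ.<-trans
      (ℤ.+-mono-≤-< (ℤ.neg-mono-≤ (ℤ.*-monoˡ-≤-nonNeg (+ 2) (degree≥0 x))) (ℤ.neg-mono-< d<k))
      ℤ.-<+

    -- s + r is s + (s - (s - r)), and s - r has lower degree than s; the coefficient evaluates to
    -- 2.
    s+r-leading : Leading (s ⊕ r) (+ suc d) (1ℚ ℚ.+ (1ℚ ℚ.- 0ℚ))
    s+r-leading = leading-resp
      (solve 2 (λ s r → s :+ (s :- (s :- r)) := s :+ r) ≋-refl s r)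
      (leading-⊕ s-leading (leading-⊕ s-leading (leading-⊝ (≼∧<⇒leading-zero close close<d))))

    z≋polynomial : z ≋ s ⊗ s ⊗ (q ⊗ q) ⊖ p ⊗ p
    z≋polynomial = begin
      (s ⊖ r) ⊗ (s ⊕ r) ⊗ q ⊗ q
        ≈⟨ solve 3 (λ s r q → (s :- r) :* (s :+ r) :* q :* q
             := s :* s :* (q :* q) :- (r :* q) :* (r :* q)) ≋-refl s r q ⟩
      s ⊗ s ⊗ (q ⊗ q) ⊖ (r ⊗ q) ⊗ (r ⊗ q)
        ≈⟨ ⊕-cong ≋-refl (⊝-cong (⊗-cong (fraction-quotient x) (fraction-quotient x))) ⟩
      s ⊗ s ⊗ (q ⊗ q) ⊖ p ⊗ p ∎

    z-degree : ℤ.- (+ 2 ℤ.* deg-q) ℤ.- k ℤ.+ + suc d ℤ.+ deg-q ℤ.+ deg-q ℤ.< + 0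
    z-degree = subst₂ ℤ._<_ (eq deg-q k (+ suc d)) (ℤ.+-inverseʳ k) (ℤ.+-monoˡ-< (ℤ.- k) d<k)
      where
      eq : ∀ m k d → d ℤ.- k ≡ ℤ.- (+ 2 ℤ.* m) ℤ.- k ℤ.+ d ℤ.+ m ℤ.+ m
      eq = solve-∀

    z≋0 : z ≋ 0ᴸ
    z≋0 = polynomial-degree<0
      (polynomial-resp (≋-sym z≋polynomial)
        (polynomial-⊕ (polynomial-⊗ s²-polynomial
            (polynomial-⊗ (fraction-q-polynomial x) (fraction-q-polynomial x)))
          (polynomial-⊝ (polynomial-⊗ (fraction-p-polynomial x) (fraction-p-polynomial x)))))
      (≼-⊗ (≼-⊗ (≼-⊗ close (degree s+r-leading)) (degree q-leading)) (degree q-leading))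
      z-degree
      where
      q-leading = fraction-q-leading x

    s-r≋0 : s ⊖ r ≋ 0ᴸ
    s-r≋0 = ⊗-cancel-≋0 s+r-leading 2≢0
      (⊗-cancel-≋0 q-leading q₀≢0 (⊗-cancel-≋0 q-leading q₀≢0 z≋0))
      where
      q-leading = fraction-q-leading x
      q₀≢0 = proj₂ (Fraction.q-degree x)

  module _ {m : ℕ} (solution : PellSolution s (suc d) m) where
    open PellSolution solution
    open ≋-Reasoning

    q⁻¹ : ∃[ h ] q ⊗ h ≋ 1ᴸ × h ≼ ℤ.- + m
    q⁻¹ = inverse (q-degree , refl) q-leading≢0

    quotient : Laurent
    quotient = p ⊗ proj₁ q⁻¹

    quotient⊗q≋p : quotient ⊗ q ≋ p
    quotient⊗q≋p = modulo p p (proj₁ (proj₂ q⁻¹))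
      (solve 3 (λ p q h → p :* h :* q := p :+ p :* (q :* h :- con 1ℚ)) ≋-refl p q (proj₁ q⁻¹))

    opaque
      unfolding _≋_ _≼_ Polynomial _⊗_

      pell-fraction : Fraction
      pell-fraction = record
        { p = p ; q = q
        ; p-polynomial = p-polynomial ; q-polynomial = q-polynomial
        ; deg-q = + m ; q-degree = q-degree , q-leading≢0
        ; p/q = quotient ; p/q-quotient = quotient⊗q≋p
        }

    -- As s - p/q = -(p - qs)/q, the bounds `-(m + suc d)` for p - qs and `-m` for 1/q add up.
    quotient-close : s ⊖ quotient ≼ ℤ.- (+ 2 ℤ.* + m) ℤ.- + suc d
    quotient-close = ≼-resp
      (≋-sym (modulo (⊝ ((p ⊖ q ⊗ s) ⊗ h)) s (≋-sym (proj₁ (proj₂ q⁻¹)))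
        (solve 4 (λ s p q h → s :- p :* h
                := :- ((p :- q :* s) :* h) :+ s :* (con 1ℚ :- q :* h)) ≋-refl s p q h)))
      (≼-⊝ (subst ((p ⊖ q ⊗ s) ⊗ h ≼_) (eq (+ m) (+ suc d)) (≼-⊗ remainder (proj₂ (proj₂ q⁻¹)))))
      where
      h : Laurent
      h = proj₁ q⁻¹
      eq : ∀ m d → ℤ.- (m ℤ.+ d) ℤ.+ ℤ.- m ≡ ℤ.- (+ 2 ℤ.* m) ℤ.- d
      eq = solve-∀

    -- As p² − s²q² = 1, an equality p/q = p′/q′ forces q to divide q′.
    denominator-multiple : ∀ x → quotient ≋ Fraction.p/q x →
      ∃[ w ] Polynomial w × Fraction.q x ≋ w ⊗ q
    -- The factor is (p - qs)(p′ + q′s), in which the coefficient pq′ - p′q of s vanishes.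
    denominator-multiple x r≋r′ = p ⊗ p′ ⊖ s ⊗ s ⊗ (q ⊗ q′) ,
      polynomial-⊕ (polynomial-⊗ p-polynomial (fraction-p-polynomial x))
        (polynomial-⊝ (polynomial-⊗ s²-polynomial
          (polynomial-⊗ q-polynomial (fraction-q-polynomial x)))) ,
      (begin
        q′
          ≈⟨ modulo (p ⊗ (p ⊗ q′) ⊖ s ⊗ s ⊗ (q ⊗ q′) ⊗ q) q′ (≋-sym norm)
               (solve 4 (λ p q s q′ → q′ := p :* (p :* q′) :- s :* s :* (q :* q′) :* q
                    :+ q′ :* (con 1ℚ :- (p :* p :- s :* s :* (q :* q)))) ≋-refl p q s q′) ⟩
        p ⊗ (p ⊗ q′) ⊖ s ⊗ s ⊗ (q ⊗ q′) ⊗ q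
          ≈⟨ ⊕-cong (⊗-cong ≋-refl p⊗q′≋p′⊗q) ≋-refl ⟩
        p ⊗ (p′ ⊗ q) ⊖ s ⊗ s ⊗ (q ⊗ q′) ⊗ q
          ≈⟨ solve 5 (λ p q s p′ q′ → p :* (p′ :* q) :- s :* s :* (q :* q′) :* q
                := (p :* p′ :- s :* s :* (q :* q′)) :* q) ≋-refl p q s p′ q′ ⟩
        (p ⊗ p′ ⊖ s ⊗ s ⊗ (q ⊗ q′)) ⊗ q ∎)
      where
      open Fraction x using () renaming (p to p′; q to q′; p/q to r′)
      p⊗q′≋p′⊗q : p ⊗ q′ ≋ p′ ⊗ q
      p⊗q′≋p′⊗q = begin
        p ⊗ q′          ≈⟨ ⊗-cong quotient⊗q≋p ≋-refl ⟨
        quotient ⊗ q ⊗ q′      ≈⟨ ⊗-cong (⊗-cong r≋r′ ≋-refl) ≋-refl ⟩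
        r′ ⊗ q ⊗ q′     ≈⟨ solve 3 (λ r q q′ → r :* q :* q′ := r :* q′ :* q) ≋-refl r′ q q′ ⟩
        r′ ⊗ q′ ⊗ q     ≈⟨ ⊗-cong (fraction-quotient x) ≋-refl ⟩
        p′ ⊗ q          ∎

  -- If the values agreed, the denominator of `x` would be wq for a polynomial w. Since q has degree
  -- above N, w would have negative degree and vanish, and the denominator with it.
  pell-fraction-new : ∀ {N o} (solution : PellSolution s (suc d) (suc (N ℕ.+ o))) →
    ∀ x → degree-ℕ x ℕ.≤ N → ¬ quotient solution ≋ Fraction.p/q x
  pell-fraction-new {N} {o} solution x m≤N r≋r′ = q≉0 x (begin
    Fraction.q x   ≈⟨ q′≋wq ⟩
    w ⊗ q          ≈⟨ ⊗-cong w≋0 ≋-refl ⟩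
    0ᴸ ⊗ q         ≈⟨ ⊗-zeroˡ q ⟩
    0ᴸ             ∎)
    where
    open ≋-Reasoning
    open PellSolution solution using (q)
    multiple : ∃[ w ] Polynomial w × Fraction.q x ≋ w ⊗ q
    multiple = denominator-multiple solution x r≋r′
    w : Laurent
    w = proj₁ multiple
    q′≋wq : Fraction.q x ≋ w ⊗ q
    q′≋wq = proj₂ (proj₂ multiple)
    w≋0 : w ≋ 0ᴸ
    w≋0 = polynomial-degree<0 (proj₁ (proj₂ multiple))
      (≼-resp (≋-sym (divide (proj₁ (proj₂ (q⁻¹ solution))) (≋-sym q′≋wq)))
        (≼-⊗ (≼-mono (ℤ.+≤+ m≤N) (fraction-q≼ x)) (proj₂ (proj₂ (q⁻¹ solution)))))
      (subst (λ i → + N ℤ.+ (ℤ.- + i) ℤ.< + 0) (ℕ.+-identityʳ (suc (N ℕ.+ o)))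
        (degree-exceeded N o 0))

  degrees-bounded : ∀ xs → ∃[ N ] All (λ x → degree-ℕ x ℕ.≤ N) xs
  degrees-bounded []       = 0 , []
  degrees-bounded (x ∷ xs) =
    let N , bounded = degrees-bounded xs in
    degree-ℕ x ℕ.+ N , ℕ.m≤m+n _ N ∷ All.map (λ m≤N → ℕ.≤-trans m≤N (ℕ.m≤n+m N _)) bounded

  opaque
    unfolding _≋_ _≼_ _⊕_ ⊝_ pell-fraction

    isLagrangeConstant : IsLagrangeConstant s [ + suc d ]
    isLagrangeConstant = record
      { irrational = irrational
      -- The supremum is attained, so every upper bound lies above it at once.
      ; supremum   = bounded , λ u upper → upper (+ suc d) approximable
      }
      where
      bounded : IsUpperBound (ApproximableTo s) [ + suc d ]
      bounded k approximable with k ℤ.≤? + suc d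
      ... | yes k≤d = [ k≤d ]
      ... | no  k≰d =
        -- A single approximation this close is impossible, so the empty list of excluded fractions
        -- suffices.
        let x , close , _ = approximable [] in
        contradiction (ℤ.≰⇒> k≰d) (approximation-bounded x close)

      approximable : ApproximableTo s (+ suc d)
      approximable xs =
        let N , N-bounds = degrees-bounded xs
            o , solution = pell N in
        pell-fraction solution , quotient-close solution ,
        All.map (λ {x} → pell-fraction-new solution x) N-bounds

-- The expansion of √(A² + ε)

opaque
  unfolding _≋_ _≼_ _⊕_ _⊗_ monomial Polynomial

  leading⇒deg : ∀ {f n a} → Leading f n a → a ≢ 0ℚ → deg f ≡ n
  leading⇒deg (f≼n , eq) a≢0 = f≼n , a≢0 ∘ trans (sym eq)

  deg-resp : ∀ {f g n} → g ≋ f → deg f ≡ n → deg g ≡ n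
  deg-resp {n = n} g≋f (f≼n , f≢0) =
    (λ i n<i → trans (g≋f i) (f≼n i n<i)) , f≢0 ∘ trans (sym (g≋f n))

  square-root⇒leading : ∀ d m n s → IsSquareRoot d (T^ m + T^ n) s → Leading s (+ d) 1ℚ
  square-root⇒leading _ _ _ _ (_ , s≼d , s-coeff) = s≼d , s-coeff

  square-root⇒≋ : ∀ d m n s → IsSquareRoot d (T^ m + T^ n) s →
                  s ⊗ s ≋ monomial 1ℚ m ⊕ monomial 1ℚ n
  square-root⇒≋ _ _ _ _ (eq , _) = eq

  ≋⇒square-root : ∀ {d m n s} → Leading s (+ d) 1ℚ →
                  s ⊗ s ≋ monomial 1ℚ m ⊕ monomial 1ℚ n → IsSquareRoot d (T^ m + T^ n) s
  ≋⇒square-root (s≼d , s-coeff) eq = eq , s≼d , s-coeff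

monomial-cong : ∀ {a b m n} → a ≡ b → m ≡ n → monomial a m ≋ monomial b n
monomial-cong refl refl = ≋-refl

monomial-square : ∀ d → monomial 1ℚ (+ d) ⊗ monomial 1ℚ (+ d) ≋ monomial 1ℚ (+ (2 ℕ.* d))
monomial-square d = ≋-trans (monomial-⊗ 1ℚ 1ℚ (+ d) (+ d))
  (monomial-cong refl (cong (λ n → + (d ℕ.+ n)) (sym (ℕ.+-identityʳ d))))

-- T²ᵈ + Tⁱ is T²ᵈ (1 + 4v) with v = Tⁱ⁻²ᵈ/4, and i < 2d makes the degree of v negative; so the root
-- is Tᵈ times that of 1 + 4v.
square-root-exists : ∀ d i → i ℕ.< 2 ℕ.* d → ∃[ s ] IsSquareRoot d (T^ (+ (2 ℕ.* d)) + T^ (+ i)) s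
square-root-exists d i i<2d =
  let y , y≼-1 , eq = square-root-1+4v v≼-1 in
  t ⊗ (1ᴸ ⊕ y) , ≋⇒square-root
    (subst (λ n → Leading (t ⊗ (1ᴸ ⊕ y)) n 1ℚ) (ℤ.+-identityʳ (+ d))
      (leading-⊗ (leading-monomial 1ℚ (+ d))
        (leading-⊕ (leading-monomial 1ℚ (+ 0)) (≼∧<⇒leading-zero y≼-1 ℤ.-<+))))
    (begin
      t ⊗ (1ᴸ ⊕ y) ⊗ (t ⊗ (1ᴸ ⊕ y))
        ≈⟨ solve 2 (λ t z → t :* z :* (t :* z) := t :* t :* (z :* z)) ≋-refl t (1ᴸ ⊕ y) ⟩
      t ⊗ t ⊗ ((1ᴸ ⊕ y) ⊗ (1ᴸ ⊕ y))
        ≈⟨ ⊗-cong (monomial-square d) eq ⟩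
      t² ⊗ (1ᴸ ⊕ 2ᴸ ⊗ (2ᴸ ⊗ v))
        ≈⟨ solve 3 (λ w u v → w :* (con 1ℚ :+ u :* (u :* v)) := w :+ u :* (u :* (w :* v)))
             ≋-refl t² 2ᴸ v ⟩
      t² ⊕ 2ᴸ ⊗ (2ᴸ ⊗ (t² ⊗ v))
        ≈⟨ ⊕-cong ≋-refl (⊗-cong ≋-refl (⊗-cong ≋-refl
             (≋-trans (monomial-⊗ _ _ _ _) (monomial-cong refl degree-t²v)))) ⟩
      t² ⊕ 2ᴸ ⊗ (2ᴸ ⊗ monomial (1ℚ ℚ.* (½ ℚ.* ½)) (+ i))
        ≈⟨ ⊕-cong ≋-refl (≋-trans (⊗-cong ≋-refl (monomial-⊗ _ _ _ _)) (monomial-⊗ _ _ _ _)) ⟩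
      t² ⊕ monomial 1ℚ (+ i) ∎)
  where
  open ≋-Reasoning
  j : ℕ
  j = proj₁ (ℕ.m≤n⇒∃[o]m+o≡n i<2d)
  t t² v : Laurent
  t  = monomial 1ℚ (+ d)
  t² = monomial 1ℚ (+ (2 ℕ.* d))
  v  = monomial (½ ℚ.* ½) -[1+ j ]

  v≼-1 : v ≼ -[1+ 0 ]
  v≼-1 = ≼-mono (ℤ.-≤- ℕ.z≤n) ≼-monomial

  degree-t²v : + (2 ℕ.* d) ℤ.+ -[1+ j ] ≡ + i
  degree-t²v = trans (cong (λ n → + n ℤ.+ -[1+ j ]) (sym (proj₂ (ℕ.m≤n⇒∃[o]m+o≡n i<2d))))
    (eq (+ i) (+ j))
    where
    eq : ∀ i j → ℤ.1ℤ ℤ.+ i ℤ.+ j ℤ.+ ℤ.- (ℤ.1ℤ ℤ.+ j) ≡ i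
    eq = solve-∀

-- The common core of both cases, with `ε′` for 1/ε; that `ε′ ⊗ A` is a polynomial makes 2A/ε
-- eligible as a partial quotient. Writing d as `suc (e + k)` encodes e < d and gives d - e as
-- `suc k`, without subtraction.
module _ {s A ε′ : Laurent} {e k : ℕ} {c : ℚ}
  (s-leading : Leading s (+ suc (e ℕ.+ k)) 1ℚ)
  (A-leading : Leading A (+ suc (e ℕ.+ k)) 1ℚ)
  (ε′-leading : Leading ε′ (ℤ.- + e) c)
  (c≢0 : c ≢ 0ℚ)
  (A-polynomial : Polynomial A)
  (ε′A-polynomial : Polynomial (ε′ ⊗ A))
  (s²-polynomial : Polynomial (s ⊗ s))
  (s²-A²-degree : s ⊗ s ⊖ A ⊗ A ≼ + e)
  (ε′-inverse : ε′ ⊗ (s ⊗ s ⊖ A ⊗ A) ≋ 1ᴸ)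
  where

  private
    d : ℕ
    d = suc (e ℕ.+ k)

    B : Laurent
    B = 2ᴸ ⊗ (ε′ ⊗ A)

  B-polynomial : Polynomial B
  B-polynomial = polynomial-⊗ (polynomial-monomial _ 0) ε′A-polynomial

  B-leading : Leading B (+ suc k) ((1ℚ ℚ.+ 1ℚ) ℚ.* (c ℚ.* 1ℚ))
  B-leading = subst (λ n → Leading B n _) (eq (+ e) (+ k))
    (leading-⊗ (leading-monomial _ (+ 0)) (leading-⊗ ε′-leading A-leading))
    where
    eq : ∀ e k → + 0 ℤ.+ (ℤ.- e ℤ.+ (ℤ.1ℤ ℤ.+ (e ℤ.+ k))) ≡ ℤ.1ℤ ℤ.+ k
    eq = solve-∀

  B-leading≢0 : (1ℚ ℚ.+ 1ℚ) ℚ.* (c ℚ.* 1ℚ) ≢ 0ℚ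
  B-leading≢0 = *-≢0 2≢0 (*-≢0 c≢0 λ ())

  -- s - A is ε/(s + A), where s + A has leading coefficient 2 and degree d; so the bound is e - d.
  s-A≼ : s ⊖ A ≼ -[1+ k ]
  s-A≼ =
    let h , inv , h≼ = inverse (leading-⊕ s-leading A-leading) 2≢0 in
    ≼-resp
      (≋-sym (divide inv (solve 2 (λ s A → (s :- A) :* (s :+ A) := s :* s :- A :* A) ≋-refl s A)))
      (subst ((s ⊗ s ⊖ A ⊗ A) ⊗ h ≼_) (eq (+ e) (+ k)) (≼-⊗ s²-A²-degree h≼))
    where
    eq : ∀ e k → e ℤ.- (ℤ.1ℤ ℤ.+ (e ℤ.+ k)) ≡ ℤ.- (ℤ.1ℤ ℤ.+ k)
    eq = solve-∀

  s-A≼-1 : s ⊖ A ≼ -[1+ 0 ]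
  s-A≼-1 = ≼-mono (ℤ.-≤- ℕ.z≤n) s-A≼

  -- Index 0 is the preperiod; the period of length two starts at index 1, hence the recursion from
  -- `3 + h` to `1 + h`.
  complete-quotient partial-quotient : ℕ → Laurent
  complete-quotient 0                   = s
  complete-quotient 1                   = ε′ ⊗ (s ⊕ A)
  complete-quotient 2                   = s ⊕ A
  complete-quotient (suc (suc (suc h))) = complete-quotient (suc h)

  partial-quotient 0                   = A
  partial-quotient 1                   = B
  partial-quotient 2                   = 2ᴸ ⊗ A
  partial-quotient (suc (suc (suc h))) = partial-quotient (suc h)

  partial-quotient-polynomial : ∀ h → Polynomial (partial-quotient h)
  partial-quotient-polynomial 0                   = A-polynomial
  partial-quotient-polynomial 1                   = B-polynomial
  partial-quotient-polynomial 2                   = polynomial-⊗ (polynomial-monomial _ 0) A-polynomial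
  partial-quotient-polynomial (suc (suc (suc h))) = partial-quotient-polynomial (suc h)

  even-degree : ∀ h → 2 ∣ h → deg (partial-quotient h) ≡ + d
  even-degree 0 _ = leading⇒deg A-leading λ ()
  even-degree 1 2∣1 = contradiction (∣⇒≤ 2∣1) λ { (ℕ.s≤s ()) }
  even-degree 2 _ = leading⇒deg (leading-⊗ (leading-monomial _ (+ 0)) A-leading) λ ()
  even-degree (suc (suc (suc h))) 2∣3+h = even-degree (suc h) (∣m+n∣m⇒∣n 2∣3+h ∣-refl)

  odd-degree : ∀ h → 2 ∤ h → deg (partial-quotient h) ≡ (+ d ℤ.- + e)
  odd-degree 0 2∤0 = contradiction (2 ∣0) 2∤0
  odd-degree 1 _ = leading⇒deg (subst (λ n → Leading B n _) (eq (+ e) (+ k)) B-leading) B-leading≢0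
    where
    eq : ∀ e k → ℤ.1ℤ ℤ.+ k ≡ ℤ.1ℤ ℤ.+ (e ℤ.+ k) ℤ.- e
    eq = solve-∀
  odd-degree 2 2∤2 = contradiction ∣-refl 2∤2
  odd-degree (suc (suc (suc h))) 2∤3+h =
    odd-degree (suc h) λ 2∣1+h → 2∤3+h (∣m∣n⇒∣m+n ∣-refl 2∣1+h)

  fractional-part : ∀ h → complete-quotient h ⊖ partial-quotient h ≼ -[1+ 0 ]
  fractional-part 0 = s-A≼-1
  fractional-part 1 = ≼-resp
    (solve 3 (λ s A ε′ → ε′ :* (s :- A)
        := ε′ :* (s :+ A) :- con (1ℚ ℚ.+ 1ℚ) :* (ε′ :* A)) ≋-refl s A ε′)
    (≼-mono (slack (e ℕ.+ k) (eq (+ e) (+ k))) (≼-⊗ (degree ε′-leading) s-A≼))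
    where
    eq : ∀ e k → ℤ.- e ℤ.+ ℤ.- (ℤ.1ℤ ℤ.+ k) ℤ.+ (e ℤ.+ k) ≡ ℤ.- ℤ.1ℤ
    eq = solve-∀
  fractional-part 2 = ≼-resp
    (solve 2 (λ s A → s :- A := s :+ A :- con (1ℚ ℚ.+ 1ℚ) :* A) ≋-refl s A) s-A≼-1
  fractional-part (suc (suc (suc h))) = fractional-part (suc h)

  complete-quotient-suc : ∀ h →
    complete-quotient (suc h) ⊗ (complete-quotient h ⊖ partial-quotient h) ≋ 1ᴸ
  complete-quotient-suc 0 = ≋-trans
    (solve 3 (λ s A ε′ → ε′ :* (s :+ A) :* (s :- A) := ε′ :* (s :* s :- A :* A)) ≋-refl s A ε′)
    ε′-inverse
  complete-quotient-suc 1 = ≋-trans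
    (solve 3 (λ s A ε′ → (s :+ A) :* (ε′ :* (s :+ A) :- con (1ℚ ℚ.+ 1ℚ) :* (ε′ :* A))
        := ε′ :* (s :* s :- A :* A)) ≋-refl s A ε′)
    ε′-inverse
  complete-quotient-suc 2 = ≋-trans
    (solve 3 (λ s A ε′ → ε′ :* (s :+ A) :* (s :+ A :- con (1ℚ ℚ.+ 1ℚ) :* A)
        := ε′ :* (s :* s :- A :* A)) ≋-refl s A ε′)
    ε′-inverse
  complete-quotient-suc (suc (suc (suc h))) = complete-quotient-suc (suc h)

  -- p/q is the convergent A + 1/B, which ends just before the partial quotient 2A. Since 1 = ε′ (s
  -- - A)(s + A), the remainder 1 - B (s - A) equals ε′ (s - A)², of degree at most -e - 2 (d - e) =
  -- -((d - e) + d).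
  fundamental-solution : PellSolution s d (suc k)
  fundamental-solution = record
    { p = 1ᴸ ⊕ B ⊗ A
    ; q = B
    ; p-polynomial = polynomial-⊕ (polynomial-monomial 1ℚ 0) (polynomial-⊗ B-polynomial A-polynomial)
    ; q-polynomial = B-polynomial
    ; q-degree = degree B-leading
    ; q-leading≢0 = B-leading≢0 ∘ trans (sym (coefficient B-leading))
    ; norm = modulo 1ᴸ (⊝ (2ᴸ ⊗ 2ᴸ ⊗ ε′ ⊗ A ⊗ A)) ε′-inverse
        (solve 3 (λ s A ε′ → let two = con (1ℚ ℚ.+ 1ℚ) ; b = two :* (ε′ :* A) ; p = con 1ℚ :+ b :* A in
             p :* p :- s :* s :* (b :* b)
          := con 1ℚ :+ (:- (two :* two :* ε′ :* A :* A)) :* (ε′ :* (s :* s :- A :* A) :- con 1ℚ))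
          ≋-refl s A ε′)
    ; remainder = ≼-resp
        (≋-sym (modulo (ε′ ⊗ (s ⊖ A) ⊗ (s ⊖ A)) 1ᴸ (≋-sym ε′-inverse)
          (solve 3 (λ s A ε′ → let b = con (1ℚ ℚ.+ 1ℚ) :* (ε′ :* A) in
               con 1ℚ :+ b :* A :- b :* s
            := ε′ :* (s :- A) :* (s :- A) :+ con 1ℚ :* (con 1ℚ :- ε′ :* (s :* s :- A :* A)))
            ≋-refl s A ε′)))
        (subst (ε′ ⊗ (s ⊖ A) ⊗ (s ⊖ A) ≼_) (eq (+ e) (+ k))
          (≼-⊗ (≼-⊗ (degree ε′-leading) s-A≼) s-A≼))
    }
    where
    eq : ∀ e k → ℤ.- e ℤ.+ ℤ.- (ℤ.1ℤ ℤ.+ k) ℤ.+ ℤ.- (ℤ.1ℤ ℤ.+ k)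
               ≡ ℤ.- (ℤ.1ℤ ℤ.+ k ℤ.+ (ℤ.1ℤ ℤ.+ (e ℤ.+ k)))
    eq = solve-∀

  expansion :
    The (IsContinuedFraction s) (λ a →
      (∀ h → 2 ∣ h → deg (a h) ≡ + d) × (∀ h → 2 ∤ h → deg (a h) ≡ (+ d ℤ.- + e))) ×
    IsLagrangeConstant s [ + d ]
  expansion =
    ((partial-quotient , isContinuedFraction s complete-quotient partial-quotient
        ≋-refl partial-quotient-polynomial fractional-part complete-quotient-suc) ,
     λ a cf →
       let a≋b = continuedFraction-unique s complete-quotient partial-quotient
             ≋-refl partial-quotient-polynomial fractional-part complete-quotient-suc cf in
       (λ h 2∣h → deg-resp (a≋b h) (even-degree h 2∣h)) ,
       (λ h 2∤h → deg-resp (a≋b h) (odd-degree h 2∤h))) ,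
    isLagrangeConstant s-leading s²-polynomial
      (unbounded s-leading s²-polynomial fundamental-solution)

-- The two families of D

T²ᵈ+Tᵉ : ∀ e k → let d = suc (e ℕ.+ k) in
  The (IsSquareRoot d (T^ (+ (2 ℕ.* d)) + T^ (+ e))) λ √D →
    The (IsContinuedFraction √D) (λ a →
      (∀ h → 2 ∣ h → deg (a h) ≡ + d) ×
      (∀ h → 2 ∤ h → deg (a h) ≡ (+ d ℤ.- + e))) ×
    IsLagrangeConstant √D [ + d ]
T²ᵈ+Tᵉ e k = square-root-exists d e (ℕ.≤-trans (ℕ.s≤s (ℕ.m≤m+n e k)) (ℕ.m≤m+n d _)) , λ s root →
  let s² = square-root⇒≋ d (+ (2 ℕ.* d)) (+ e) s root
      difference : s ⊗ s ⊖ t ⊗ t ≋ monomial 1ℚ (+ e)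
      difference = ≋-trans (⊕-cong s² (⊝-cong (monomial-square d)))
        (solve 2 (λ x y → x :+ y :- x := y) ≋-refl _ _)
  in expansion (square-root⇒leading d (+ (2 ℕ.* d)) (+ e) s root)
       (leading-monomial 1ℚ (+ d)) (leading-monomial 1ℚ (ℤ.- + e)) (λ ())
       (polynomial-monomial 1ℚ d)
       (polynomial-resp
         (≋-sym (≋-trans (monomial-⊗ 1ℚ 1ℚ _ _) (monomial-cong refl (eq (+ e) (+ k)))))
         (polynomial-monomial 1ℚ (suc k)))
       (polynomial-resp (≋-sym s²)
         (polynomial-⊕ (polynomial-monomial 1ℚ _) (polynomial-monomial 1ℚ e)))
       (≼-resp (≋-sym difference) ≼-monomial)
       (≋-trans (⊗-cong ≋-refl difference)
         (≋-trans (monomial-⊗ 1ℚ 1ℚ _ _) (monomial-cong refl (ℤ.+-inverseˡ (+ e)))))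
  where
  d : ℕ
  d = suc (e ℕ.+ k)
  t : Laurent
  t = monomial 1ℚ (+ d)
  eq : ∀ e k → ℤ.- e ℤ.+ (ℤ.1ℤ ℤ.+ (e ℤ.+ k)) ≡ ℤ.1ℤ ℤ.+ k
  eq = solve-∀

T²ᵈ+Tᵈ : ∀ k → let d = suc k in
  The (IsSquareRoot d (T^ (+ (2 ℕ.* d)) + T^ (+ d))) λ √D →
    The (IsContinuedFraction √D) (λ a → ∀ h → deg (a h) ≡ + d) ×
    IsLagrangeConstant √D [ + d ]
T²ᵈ+Tᵈ k = square-root-exists d d
    (ℕ.s≤s (ℕ.m≤n⇒m≤o+n k (ℕ.≤-reflexive (sym (ℕ.+-identityʳ d))))) , λ s root →
  let s² = square-root⇒≋ d (+ (2 ℕ.* d)) (+ d) s root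
      difference : s ⊗ s ⊖ A ⊗ A ≋ const (ℚ.- (½ ℚ.* ½))
      difference = ≋-trans (⊕-cong (≋-trans s² (⊕-cong (≋-sym (monomial-square d)) ≋-refl)) ≋-refl)
        (solve 1 (λ t → t :* t :+ t :- (t :+ con ½) :* (t :+ con ½) := con (ℚ.- (½ ℚ.* ½)))
           ≋-refl t)
      -- The constant -4 is the inverse of what completing the square leaves over, and constants
      -- have degree 0.
      (cf , degrees) , lagrange = expansion {ε′ = const -4ℚ} {e = 0}
        (square-root⇒leading d (+ (2 ℕ.* d)) (+ d) s root)
        (leading-⊕ (leading-monomial 1ℚ (+ d)) (≼∧<⇒leading-zero ≼-monomial (ℤ.+<+ ℕ.z<s)))
        (leading-monomial -4ℚ (+ 0)) (λ ())
        A-polynomial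
        (polynomial-⊗ (polynomial-monomial -4ℚ 0) A-polynomial)
        (polynomial-resp (≋-sym s²)
          (polynomial-⊕ (polynomial-monomial 1ℚ _) (polynomial-monomial 1ℚ d)))
        (≼-resp (≋-sym difference) ≼-monomial)
        (≋-trans (⊗-cong ≋-refl difference) (monomial-⊗ -4ℚ (ℚ.- (½ ℚ.* ½)) (+ 0) (+ 0)))
  in (cf , λ a a-cf h → constant-degree {a} (degrees a a-cf) h) , lagrange
  where
  d : ℕ
  d = suc k
  -4ℚ : ℚ
  -4ℚ = ℚ.- (+ 4 ℚ./ 1)
  t A : Laurent
  t = monomial 1ℚ (+ d)
  A = t ⊕ const ½
  A-polynomial : Polynomial A
  A-polynomial = polynomial-⊕ (polynomial-monomial 1ℚ d) (polynomial-monomial ½ 0)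
  constant-degree : ∀ {a : ℕ → Laurent} →
    (∀ h → 2 ∣ h → deg (a h) ≡ + d) × (∀ h → 2 ∤ h → deg (a h) ≡ (+ d ℤ.- + 0)) →
    ∀ h → deg (a h) ≡ + d
  constant-degree {a} (even , odd) h with 2 ∣? h
  ... | yes 2∣h = even h 2∣h
  ... | no  2∤h = subst (deg_≡_ (a h)) (ℤ.+-identityʳ (+ d)) (odd h 2∤h)

theorem3 : ∀ (d : ℕ) → 0 ℕ.< d →
    (∀ (e : ℕ) → e ℕ.< d →
    The (IsSquareRoot d (T^ (+ (2 ℕ.* d)) + T^ (+ e))) λ √D →
    The (IsContinuedFraction √D) (λ a →
    (∀ h → 2 ∣ h → deg (a h) ≡ + d) ×
    (∀ h → 2 ∤ h → deg (a h) ≡ (+ d ℤ.- + e))) ×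
    IsLagrangeConstant √D [ + d ])
    ×
    (The (IsSquareRoot d (T^ (+ (2 ℕ.* d)) + T^ (+ d))) λ √D →
    The (IsContinuedFraction √D) (λ a →
    ∀ h → deg (a h) ≡ + d) ×
    IsLagrangeConstant √D [ + d ])
theorem3 (suc k) _ = below , T²ᵈ+Tᵈ k
  where
  below : ∀ e → e ℕ.< suc k → _
  below e e<d with ℕ.m≤n⇒∃[o]m+o≡n e<d
  ... | j , refl = T²ᵈ+Tᵉ e j
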